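{- Let $G\subset\mathbb{F}_q^k$ be an arc and let $n\in\mathbb{N}$ be a natural number such that \[ n+k-1\le |G|\le \frac{q+2k-2+n}{2}. \] If the column space of the matrix $M_G^{\uparrow n}$ (over $\mathbb{F}_q$) contains a vector of weight one (a vector with exactly one nonzero coordinate), then the arc $G$ cannot be extended to an arc of size $q+2k-1+n-|G|$, i.e. there is no arc of that size in $\mathbb{F}_q^k$ containing $G$ as a subfamily.
   Context: $\mathbb{F}_q$ is a finite field of order $q$ and characteristic $p$. An arc in $\mathbb{F}_q^k$ is an ordered family of at least $k$ vectors in which every subfamily of size $k$ is a basis of $\mathbb{F}_q^k$; subfamilies inherit the order. $\binom{X}{m}$ is the set of $m$-subsets of $X$. For a basis $B$ of $\mathbb{F}_q^k$, a vector $u$ and $C\in\binom{G}{k-1}$, $\det(u,C)_B$ is the determinant of the $k\times k$ matrix whose first row is $u$ written with respect to $B$ and whose last $k-1$ rows are the elements of $C$ written with respect to $B$ in the order inherited from $G$. For $0\le n\le|G|-k+1$ and a fixed basis $B$, $M_G^{\uparrow n}$ has rows indexed by $\binom{G}{k-1}$, columns indexed by ordered pairs $(U,A)$ with $U\in\binom{G}{n}$, $A\in\binom{G\setminus U}{k-2}$, and $(C,(U,A))$-entry $\prod_{u\in U}\det(u,C)_B$ if $A\subset C\subset G\setminus U$ and $0$ otherwise. -}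

module Defs where

open import Level using (Level; _⊔_) renaming (suc to lsuc)
open import Algebra.Bundles using (CommutativeRing)
open import Data.Nat using (ℕ; zero; suc; _∸_)
open import Data.Fin using (Fin; zero; suc; toℕ; punchIn; _<_)
open import Data.Fin.Subset using (Subset; ∣_∣; _⊆_; ∁)
open import Data.Fin.Subset.Properties using (_⊆?_)
open import Data.Vec using ([]; _∷_)
open import Data.Bool using (Bool; true; false; if_then_else_; _∧_)
open import Data.List using (List; []; _∷_; _++_; map; concatMap)
open import Data.Product using (Σ; _×_; _,_; proj₁)
open import Relation.Nullary using (¬_; does)
open import Relation.Binary.PropositionalEquality using (_≡_)
import Data.Nat as N

record FiniteField (c ℓ : Level) : Set (lsuc (c ⊔ ℓ)) where
  field
    commRing : CommutativeRing c ℓ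
  open CommutativeRing commRing public
  field
    0≉1       : ¬ (0# ≈ 1#)
    inverse   : ∀ x → ¬ (x ≈ 0#) → Σ Carrier (λ y → (x * y) ≈ 1#)
    q         : ℕ
    enum      : Fin q → Carrier
    enum-inj  : ∀ i j → enum i ≈ enum j → i ≡ j
    enum-surj : ∀ x → Σ (Fin q) (λ i → enum i ≈ x)

allSubsets : (m : ℕ) → List (Subset m)
allSubsets zero = [] ∷ []
allSubsets (suc m) = map (true ∷_) (allSubsets m) ++ map (false ∷_) (allSubsets m)

elems : ∀ {m} → Subset m → List (Fin m)
elems {zero} [] = []
elems {suc m} (true ∷ p) = zero ∷ map suc (elems p)
elems {suc m} (false ∷ p) = map suc (elems p)

-- strictly increasing maps (subfamilies with inherited order)
StrictlyIncreasing : ∀ {a b} → (Fin a → Fin b) → Set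
StrictlyIncreasing σ = ∀ i j → i < j → σ i < σ j

module Arcs {c ℓ : Level} (F : FiniteField c ℓ) where
  open FiniteField F using (Carrier; _≈_; _+_; _*_; -_; 0#; 1#)

  Vec : ℕ → Set c
  Vec k = Fin k → Carrier

  _≈V_ : ∀ {k} → Vec k → Vec k → Set ℓ
  u ≈V v = ∀ i → u i ≈ v i

  Σ[_] : ∀ n → (Fin n → Carrier) → Carrier
  Σ[ zero ] f = 0#
  Σ[ suc n ] f = f zero + Σ[ n ] (λ i → f (suc i))

  sumL : List Carrier → Carrier
  sumL [] = 0#
  sumL (x ∷ xs) = x + sumL xs

  prodL : List Carrier → Carrier
  prodL [] = 1#
  prodL (x ∷ xs) = x * prodL xs

  lincomb : ∀ {j k} → (Fin j → Carrier) → (Fin j → Vec k) → Vec k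
  lincomb {j} c b i = Σ[ j ] (λ l → c l * b l i)

  Spanning : ∀ {j k} → (Fin j → Vec k) → Set (c ⊔ ℓ)
  Spanning {j} {k} b = ∀ (v : Vec k) → Σ (Fin j → Carrier) (λ a → lincomb a b ≈V v)

  LinearlyIndependent : ∀ {j k} → (Fin j → Vec k) → Set (c ⊔ ℓ)
  LinearlyIndependent {j} {k} b =
    ∀ (a : Fin j → Carrier) → lincomb a b ≈V (λ _ → 0#) → ∀ l → a l ≈ 0#

  IsBasis : ∀ {k} → (Fin k → Vec k) → Set (c ⊔ ℓ)
  IsBasis b = Spanning b × LinearlyIndependent b

  coords : ∀ {k} {b : Fin k → Vec k} → IsBasis b → Vec k → Vec k
  coords (sp , _) v = proj₁ (sp v)

  IsArc : ∀ {k m} → (Fin m → Vec k) → Set (c ⊔ ℓ)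
  IsArc {k} {m} G = (k N.≤ m) × (∀ (σ : Fin k → Fin m) → StrictlyIncreasing σ → IsBasis (λ i → G (σ i)))

  ContainsSubfamily : ∀ {k m N} → (Fin N → Vec k) → (Fin m → Vec k) → Set ℓ
  ContainsSubfamily {k} {m} {N} H G =
    Σ (Fin m → Fin N) (λ ι → StrictlyIncreasing ι × (∀ i → H (ι i) ≈V G i))

  alt : ℕ → Carrier
  alt zero = 1#
  alt (suc i) = - alt i

  det : ∀ n → (Fin n → Fin n → Carrier) → Carrier
  det zero M = 1#
  det (suc n) M = Σ[ suc n ] (λ j → (alt (toℕ j) * M zero j) * det n (λ i l → M (suc i) (punchIn j l)))

  nthD : ∀ {A : Set c} → A → List A → ℕ → A
  nthD d [] _ = d
  nthD d (x ∷ xs) zero = x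
  nthD d (x ∷ xs) (suc i) = nthD d xs i

  stackRows : ∀ {k} → Vec k → List (Vec k) → Fin k → Fin k → Carrier
  stackRows u rs zero = u
  stackRows u rs (suc i) = nthD (λ _ → 0#) rs (toℕ i)

  module Matrix {k m : ℕ} (G : Fin m → Vec k) {B : Fin k → Vec k} (bB : IsBasis B) (n : ℕ) where

    detB : Vec k → Subset m → Carrier
    detB u C = det k (stackRows (coords bB u) (map (λ g → coords bB (G g)) (elems C)))

    -- M_G^{↑n} entry at row C and column (U, A); the entry is 0 whenever
    -- (U, A) is not a valid column index (|U| = n, |A| = k-2, A ⊆ G∖U)
    -- or the condition A ⊆ C ⊆ G∖U fails.
    entry : Subset m → Subset m → Subset m → Carrier
    entry C U A =
      if does (∣ U ∣ N.≟ n) ∧ does (∣ A ∣ N.≟ (k ∸ 2)) ∧ does (A ⊆? ∁ U)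
         ∧ does (A ⊆? C) ∧ does (C ⊆? ∁ U)
      then prodL (map (λ u → detB (G u) C) (elems U))
      else 0#

    colComb : (Subset m → Subset m → Carrier) → Subset m → Carrier
    colComb x C = sumL (concatMap (λ U → map (λ A → entry C U A * x U A) (allSubsets m)) (allSubsets m))

    -- the column space of M_G^{↑n} contains a vector of weight one
    -- (rows are the (k-1)-subsets of G)
    ColSpaceHasWeightOne : Set (c ⊔ ℓ)
    ColSpaceHasWeightOne =
      Σ (Subset m → Subset m → Carrier) λ x →
      Σ (Subset m) λ C₀ →
        (∣ C₀ ∣ ≡ k ∸ 1) × ¬ (colComb x C₀ ≈ 0#)
        × (∀ C → ∣ C ∣ ≡ k ∸ 1 → ¬ (C ≡ C₀) → colComb x C ≈ 0#)

{-# OPTIONS --safe #-}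
module Submission where

-- Suppose an arc H of size q + 2k - 1 + n - |G| contains G.  For a (k-1)-subset C of G put
--   α(C) = ∏_{z ∈ H \ C} det(z , C)⁻¹ · ∏_{u ∈ G \ C} det(u , C)⁻¹ ≠ 0.
-- This vector is orthogonal to every column (U , A) of the matrix, so no vector of weight one is in the column space.
-- Modulo A, the vectors of H \ A represent distinct points of the projective line over the field, and with
-- E = G \ (A ∪ U), |H \ A| + |E| = q + 3, orthogonality reads
--   ∑_{a ∈ E} ∏_{z ∈ H \ A, z ≠ a} det(z , a , A)⁻¹ · ∏_{z ∈ E, z ≠ a} det(z , a , A)⁻¹ = 0.
-- Each summand has q + 1 factors, so by x ^ (q + 1) = x ^ 2 it is independent of signs and of the choice of
-- representatives.  Putting one point of E at infinity and using Wilson's theorem to replace a product of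
-- inverse differences by the product over the complementary points, the identity says that the divided
-- difference of a monic polynomial at deg + 1 points is 1.

open import Defs
open import Level using (Level; _⊔_)
open import Algebra.Bundles using (RawRing)
open import Algebra.Solver.Ring.AlmostCommutativeRing using (AlmostCommutativeRing; _-Raw-AlmostCommutative⟶_; fromCommutativeRing)
import Algebra.Solver.Ring
import Algebra.Properties.Ring
import Algebra.Properties.AbelianGroup
import Algebra.Properties.Semiring.Mult
import Algebra.Properties.CommutativeSemiring.Exp
import Relation.Binary.Reasoning.Setoid
open import Relation.Binary.Definitions using (tri<; tri≈; tri>)
open import Data.Nat using (ℕ; zero; suc)
import Data.Nat as ℕ
import Data.Nat.Properties as ℕ
open import Data.Nat.Solver using () renaming (module +-*-Solver to ℕ-Solver)
open import Data.Fin using (Fin; zero; suc; toℕ; punchIn; _<_)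
import Data.Fin.Properties as Fin
open import Data.List using (List; []; _∷_; _++_; map; length; allFin; filter; concatMap; replicate; tabulate; lookup)
import Data.List.Properties as List
open import Data.List.Membership.Propositional using (_∈_; _∉_)
open import Data.List.Membership.Propositional.Properties using (∈-map⁺; ∈-map⁻; ∈-++⁺ˡ; ∈-++⁺ʳ; ∈-++⁻; ∈-allFin; ∈-filter⁺; ∈-filter⁻; ∈-tabulate⁺; ∈-lookup)
open import Data.List.Membership.Propositional.Properties.WithK using (unique∧set⇒bag)
import Data.List.Membership.DecPropositional as DecMembership
open import Data.List.Relation.Binary.BagAndSetEquality using (∼bag⇒↭)
open import Data.List.Relation.Binary.Permutation.Propositional using (_↭_; prep; swap; ↭-refl; ↭-sym; ↭-trans; ↭-reflexive)
import Data.List.Relation.Binary.Permutation.Propositional as Perm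
import Data.List.Relation.Binary.Permutation.Propositional.Properties as Perm
open import Data.List.Relation.Unary.Any using (here; there)
open import Data.List.Relation.Unary.All using ([]; _∷_)
import Data.List.Relation.Unary.All as All
open import Data.List.Relation.Binary.Pointwise using (Pointwise; []; _∷_)
import Data.List.Relation.Binary.Pointwise as Pointwise
open import Data.Vec.Functional using (insertAt)
import Data.Vec.Functional.Properties as Vector
open import Data.List.Relation.Unary.AllPairs using (AllPairs; []; _∷_)
import Data.List.Relation.Unary.AllPairs.Properties as AllPairs
open import Data.List.Relation.Unary.Unique.Propositional using (Unique)
import Data.List.Relation.Unary.Unique.Propositional.Properties as Unique
open import Data.Bool using (true; false; if_then_else_)
open import Data.Fin.Subset using (Subset; ∣_∣; _⊆_; ∁) renaming (_∈_ to _∈ₛ_)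
import Data.Fin.Subset.Properties as Subset
open import Data.Vec using ([]; _∷_; here; there; _[_]≔_)
open import Data.Maybe using (Maybe; just; nothing)
open import Data.Product using (Σ; _×_; _,_; proj₁; proj₂)
open import Data.Sum using ([_,_]′)
open import Data.Empty using (⊥-elim)
open import Function using (_∘_; id; mk⇔)
open import Relation.Nullary using (¬_; Dec; yes; no; ¬?; does)
open import Relation.Nullary.Decidable using (map′; dec-true; dec-false; _×-dec_)
open import Relation.Binary.PropositionalEquality as ≡ using (_≡_; _≢_)

-- The prescribed size of `H` is what produces the exponent q + 1. Rescaling by c the representative
-- of a point outside E multiplies every summand by c⁻¹. A point a of E occurs once in each of the
-- two products of every other summand, which gain c⁻², while its own summand gains c to the power
-- -(q + 1), which is c⁻² again. So the identity survives every rescaling and may be checked in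
-- affine coordinates. Likewise, the rows of A ∪ a come in the inherited order and not with a in
-- front; this changes all q + 1 factors of a summand by one common sign, whose power is 1. The
-- product over G minus C in α is there to be cut down by the matrix entry: its factors over U
-- cancel against the entry, which leaves a product over E. Wilson's minus sign makes the sum over
-- the finite points of E equal to -1 after normalisation, and the summand at infinity is the 1 that
-- cancels it.

-- Duplicate-free lists, complements and sorting.

module _ {a} {A : Set a} where

  unique-↭ : {xs ys : List A} → Unique xs → Unique ys →
             (∀ {x} → x ∈ xs → x ∈ ys) → (∀ {x} → x ∈ ys → x ∈ xs) → xs ↭ ys
  unique-↭ ux uy to from = ∼bag⇒↭ (unique∧set⇒bag ux uy (mk⇔ to from))

  unique-++ : {xs ys : List A} → Unique xs → Unique ys →
              (∀ {x} → x ∈ xs → x ∉ ys) → Unique (xs ++ ys)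
  unique-++ ux uy disj = Unique.++⁺ ux uy λ (p , r) → disj p r

unique-∷ : ∀ {a} {A : Set a} {x : A} {xs} → x ∉ xs → Unique xs → Unique (x ∷ xs)
unique-∷ x∉ u = All.tabulate (λ y∈ e → x∉ (≡.subst (_∈ _) (≡.sym e) y∈)) ∷ u

unique-map : ∀ {a b} {A : Set a} {B : Set b} (f : A → B) {xs} →
             (∀ {x y} → x ∈ xs → y ∈ xs → f x ≡ f y → x ≡ y) → Unique xs → Unique (map f xs)
unique-map f inj []       = []
unique-map f inj (x∉ ∷ u) =
  All.tabulate (λ y∈ e → let z , z∈ , y≡ = ∈-map⁻ f y∈ in
    All.lookup x∉ z∈ (inj (here ≡.refl) (there z∈) (≡.trans e y≡)))
  ∷ unique-map f (λ x∈ y∈ → inj (there x∈) (there y∈)) u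

allPairs-lookup : ∀ {a r} {A : Set a} {R : A → A → Set r} {xs} → AllPairs R xs →
                  ∀ i j → i < j → R (lookup xs i) (lookup xs j)
allPairs-lookup (Rx ∷ _)  zero    (suc j) _           = All.lookup Rx (∈-lookup j)
allPairs-lookup (_ ∷ Rxs) (suc i) (suc j) (ℕ.s≤s i<j) = allPairs-lookup Rxs i j i<j

module _ {n : ℕ} where
  open DecMembership (Fin._≟_ {n}) using (_∈?_)

  complement : List (Fin n) → List (Fin n)
  complement xs = filter (λ i → ¬? (i ∈? xs)) (allFin n)

  ∈-complement⁺ : ∀ {xs i} → i ∉ xs → i ∈ complement xs
  ∈-complement⁺ {xs} i∉ = ∈-filter⁺ (λ i → ¬? (i ∈? xs)) (∈-allFin _) i∉

  ∈-complement⁻ : ∀ {xs i} → i ∈ complement xs → i ∉ xs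
  ∈-complement⁻ {xs} i∈ = proj₂ (∈-filter⁻ (λ i → ¬? (i ∈? xs)) {xs = allFin n} i∈)

  complement-unique : ∀ xs → Unique (complement xs)
  complement-unique xs = Unique.filter⁺ (λ i → ¬? (i ∈? xs)) (Unique.allFin⁺ n)

  ++-complement-↭ : ∀ {xs} → Unique xs → xs ++ complement xs ↭ allFin n
  ++-complement-↭ {xs} ux = unique-↭
    (unique-++ ux (complement-unique xs) λ i∈ i∈′ → ∈-complement⁻ i∈′ i∈)
    (Unique.allFin⁺ n) (λ _ → ∈-allFin _) from
    where
    from : ∀ {i} → i ∈ allFin n → i ∈ xs ++ complement xs
    from {i} _ with i ∈? xs
    ... | yes i∈ = ∈-++⁺ˡ i∈
    ... | no  i∉ = ∈-++⁺ʳ xs (∈-complement⁺ i∉)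

  length-complement : ∀ {xs} → Unique xs → length xs ℕ.+ length (complement xs) ≡ n
  length-complement {xs} ux = ≡.trans (≡.sym (List.length-++ xs))
    (≡.trans (Perm.↭-length (++-complement-↭ ux)) (List.length-tabulate id))

  sorted : List (Fin n) → List (Fin n)
  sorted xs = filter (_∈? xs) (allFin n)

  sorted-increasing : ∀ xs → AllPairs _<_ (sorted xs)
  sorted-increasing xs = AllPairs.filter⁺ (_∈? xs) (AllPairs.tabulate⁺-< id)

  ↭-sorted : ∀ {xs} → Unique xs → xs ↭ sorted xs
  ↭-sorted {xs} ux = unique-↭ ux (Unique.filter⁺ (_∈? xs) (Unique.allFin⁺ n))
    (∈-filter⁺ (_∈? xs) (∈-allFin _)) (λ x∈ → proj₂ (∈-filter⁻ (_∈? xs) {xs = allFin n} x∈))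

  -- Pigeonhole by counting: the image has `n` distinct entries, so its complement has length zero.
  map-injective-↭ : (π : Fin n → Fin n) → (∀ {i j} → π i ≡ π j → i ≡ j) → map π (allFin n) ↭ allFin n
  map-injective-↭ π inj = ↭-trans (↭-reflexive eq) (++-complement-↭ uniq)
    where
    uniq : Unique (map π (allFin n))
    uniq = Unique.map⁺ inj (Unique.allFin⁺ n)
    empty : complement (map π (allFin n)) ≡ []
    empty with complement (map π (allFin n)) | length-complement uniq
    ... | []     | _ = ≡.refl
    ... | x ∷ xs | e = ⊥-elim (ℕ.m+1+n≢m n (≡.trans (≡.cong (ℕ._+ suc (length xs))
            (≡.sym (≡.trans (List.length-map π (allFin n)) (List.length-tabulate id)))) e))
    eq : map π (allFin n) ≡ map π (allFin n) ++ complement (map π (allFin n))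
    eq = ≡.trans (≡.sym (List.++-identityʳ _)) (≡.cong (map π (allFin n) ++_) (≡.sym empty))

-- Subsets and their increasing lists of elements.

elems-∈⁺ : ∀ {m} {p : Subset m} {x} → x ∈ₛ p → x ∈ elems p
elems-∈⁺ {p = true ∷ p}  here       = here ≡.refl
elems-∈⁺ {p = true ∷ p}  (there x∈) = there (∈-map⁺ suc (elems-∈⁺ x∈))
elems-∈⁺ {p = false ∷ p} (there x∈) = ∈-map⁺ suc (elems-∈⁺ x∈)

elems-∈⁻ : ∀ {m} {p : Subset m} {x} → x ∈ elems p → x ∈ₛ p
elems-∈⁻ {p = true ∷ p}  (here ≡.refl) = here
elems-∈⁻ {p = true ∷ p}  (there x∈) with ∈-map⁻ suc x∈
... | _ , y∈ , ≡.refl = there (elems-∈⁻ y∈)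
elems-∈⁻ {p = false ∷ p} x∈ with ∈-map⁻ suc x∈
... | _ , y∈ , ≡.refl = there (elems-∈⁻ y∈)

elems-unique : ∀ {m} (p : Subset m) → Unique (elems p)
elems-unique []          = []
elems-unique (true ∷ p)  = All.tabulate (λ x∈ e → zero∉ (≡.subst (_∈ map suc (elems p)) (≡.sym e) x∈))
                           ∷ Unique.map⁺ Fin.suc-injective (elems-unique p)
  where
  zero∉ : zero ∉ map suc (elems p)
  zero∉ z∈ with ∈-map⁻ suc z∈
  ... | _ , _ , ()
elems-unique (false ∷ p) = Unique.map⁺ Fin.suc-injective (elems-unique p)

length-elems : ∀ {m} (p : Subset m) → length (elems p) ≡ ∣ p ∣
length-elems []          = ≡.refl
length-elems (true ∷ p)  = ≡.cong suc (≡.trans (List.length-map suc (elems p)) (length-elems p))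
length-elems (false ∷ p) = ≡.trans (List.length-map suc (elems p)) (length-elems p)

-- Only a permutation, since `elems` is increasing and the new index lands in the middle. This
-- permutation is the source of the signs in the determinants.
elems-insert : ∀ {m} (p : Subset m) a → a ∉ elems p → elems (p [ a ]≔ true) ↭ a ∷ elems p
elems-insert (true ∷ p)  zero    a∉ = ⊥-elim (a∉ (here ≡.refl))
elems-insert (false ∷ p) zero    a∉ = ↭-refl
elems-insert (true ∷ p)  (suc a) a∉ =
  ↭-trans (prep zero (Perm.map⁺ suc (elems-insert p a (λ a∈ → a∉ (there (∈-map⁺ suc a∈)))))) (swap zero (suc a) ↭-refl)
elems-insert (false ∷ p) (suc a) a∉ = Perm.map⁺ suc (elems-insert p a (λ a∈ → a∉ (∈-map⁺ suc a∈)))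

⊆∧∣∣≡⇒≡ : ∀ {m} {p r : Subset m} → p ⊆ r → ∣ r ∣ ≡ ∣ p ∣ → r ≡ p
⊆∧∣∣≡⇒≡ {p = []}        {[]}        p⊆r e = ≡.refl
⊆∧∣∣≡⇒≡ {p = true ∷ p}  {true ∷ r}  p⊆r e = ≡.cong (true ∷_) (⊆∧∣∣≡⇒≡ (Subset.drop-∷-⊆ p⊆r) (ℕ.suc-injective e))
⊆∧∣∣≡⇒≡ {p = true ∷ p}  {false ∷ r} p⊆r e with p⊆r here
... | ()
⊆∧∣∣≡⇒≡ {p = false ∷ p} {false ∷ r} p⊆r e = ≡.cong (false ∷_) (⊆∧∣∣≡⇒≡ (Subset.drop-∷-⊆ p⊆r) e)
⊆∧∣∣≡⇒≡ {p = false ∷ p} {true ∷ r}  p⊆r e =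
  ⊥-elim (ℕ.1+n≰n (ℕ.≤-trans (ℕ.≤-reflexive e) (Subset.p⊆q⇒∣p∣≤∣q∣ (Subset.drop-∷-⊆ p⊆r))))

-- Decidable equality and a ring solver with integer coefficients.

module Field {c ℓ : Level} (F : FiniteField c ℓ) where
  open FiniteField F hiding (zero)
  open Arcs F
  open Relation.Binary.Reasoning.Setoid setoid
  open Algebra.Properties.Ring ring using (-‿distribˡ-*; -‿distribʳ-*)
  open Algebra.Properties.AbelianGroup +-abelianGroup using (⁻¹-∙-comm; ⁻¹-involutive)
  open Algebra.Properties.Semiring.Mult semiring using (×-homo-+; ×1-homo-*) renaming (_×_ to _·_)
  open Algebra.Properties.CommutativeSemiring.Exp commutativeSemiring using (_^_; ^-homo-*)

  _≟_ : (x y : Carrier) → Dec (x ≈ y)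
  x ≟ y with enum-surj x | enum-surj y
  ... | i , p | j , r = map′ (λ { ≡.refl → trans (sym p) r })
                             (λ e → enum-inj i j (trans p (trans e (sym r)))) (i Fin.≟ j)

  private
    -- The pair (a , b) stands for the integer a - b; cancelling after each operation gives unique representatives.
    cancel : ℕ × ℕ → ℕ × ℕ
    cancel (suc a , suc b) = cancel (a , b)
    cancel (zero  , b)     = zero , b
    cancel (a     , zero)  = a , zero

    differences : RawRing _ _
    differences = record
      { Carrier = ℕ × ℕ
      ; _≈_ = _≡_
      ; _+_ = λ (a , b) (c , d) → cancel (a ℕ.+ c , b ℕ.+ d)
      ; _*_ = λ (a , b) (c , d) → cancel (a ℕ.* c ℕ.+ b ℕ.* d , a ℕ.* d ℕ.+ b ℕ.* c)
      ; -_ = λ (a , b) → b , a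
      ; 0# = 0 , 0
      ; 1# = 1 , 0
      }

    almostRing : AlmostCommutativeRing _ _
    almostRing = fromCommutativeRing commRing

    -- Clauses for 0 and 1 make these constants evaluate to 0# and 1# on the nose.
    ⟦_⟧ difference : ℕ × ℕ → Carrier
    difference (a , b) = a · 1# + - (b · 1#)
    ⟦ 0 , 0 ⟧ = 0#
    ⟦ 1 , 0 ⟧ = 1#
    ⟦ a , b ⟧ = difference (a , b)

    -0≈0 : - 0# ≈ 0#
    -0≈0 = trans (sym (+-identityˡ _)) (-‿inverseʳ 0#)

    ⟦⟧≈ : ∀ p → ⟦ p ⟧ ≈ difference p
    ⟦⟧≈ (0 , 0) = sym (-‿inverseʳ 0#)
    ⟦⟧≈ (1 , 0) = sym (trans (+-cong (+-identityʳ 1#) -0≈0) (+-identityʳ 1#))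
    ⟦⟧≈ (0 , suc b) = refl
    ⟦⟧≈ (1 , suc b) = refl
    ⟦⟧≈ (suc (suc a) , b) = refl

    interchange : ∀ a b c d → (a + b) + (c + d) ≈ (a + c) + (b + d)
    interchange a b c d = begin
      (a + b) + (c + d) ≈⟨ +-assoc _ _ _ ⟩
      a + (b + (c + d)) ≈⟨ +-congˡ (sym (+-assoc _ _ _)) ⟩
      a + ((b + c) + d) ≈⟨ +-congˡ (+-congʳ (+-comm _ _)) ⟩
      a + ((c + b) + d) ≈⟨ +-congˡ (+-assoc _ _ _) ⟩
      a + (c + (b + d)) ≈⟨ sym (+-assoc _ _ _) ⟩
      (a + c) + (b + d) ∎

    difference-+ : ∀ a b c d → (a + c) + - (b + d) ≈ (a + - b) + (c + - d)
    difference-+ a b c d = trans (+-congˡ (sym (⁻¹-∙-comm b d))) (interchange a c (- b) (- d))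

    difference-cancel : ∀ p → difference (cancel p) ≈ difference p
    difference-cancel (suc a , suc b) = begin
      difference (cancel (a , b))             ≈⟨ difference-cancel (a , b) ⟩
      a · 1# + - (b · 1#)                     ≈⟨ sym (+-identityˡ _) ⟩
      0# + (a · 1# + - (b · 1#))              ≈⟨ +-congʳ (sym (-‿inverseʳ 1#)) ⟩
      (1# + - 1#) + (a · 1# + - (b · 1#))     ≈⟨ sym (difference-+ _ _ _ _) ⟩
      (1# + a · 1#) + - (1# + b · 1#)         ∎
    difference-cancel (zero  , b)    = refl
    difference-cancel (suc a , zero) = refl

    difference-* : ∀ a b c d → (a * c + b * d) + - (a * d + b * c) ≈ (a + - b) * (c + - d)
    difference-* a b c d = begin
      (a * c + b * d) + - (a * d + b * c)             ≈⟨ difference-+ _ _ _ _ ⟩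
      (a * c + - (a * d)) + (b * d + - (b * c))       ≈⟨ +-cong (+-congˡ (-‿distribʳ-* a d)) (+-comm _ _) ⟩
      (a * c + a * - d) + (- (b * c) + b * d)         ≈⟨ +-cong (sym (distribˡ a c (- d))) (+-cong (-‿distribˡ-* b c) bd) ⟩
      a * (c + - d) + (- b * c + - b * - d)           ≈⟨ +-congˡ (sym (distribˡ (- b) c (- d))) ⟩
      a * (c + - d) + - b * (c + - d)                 ≈⟨ sym (distribʳ _ a (- b)) ⟩
      (a + - b) * (c + - d)                           ∎
      where
      bd : b * d ≈ - b * - d
      bd = begin
        b * d           ≈⟨ sym (⁻¹-involutive _) ⟩
        - - (b * d)     ≈⟨ -‿cong (-‿distribʳ-* b d) ⟩
        - (b * - d)     ≈⟨ -‿distribˡ-* b (- d) ⟩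
        - b * - d       ∎

    morphism : differences -Raw-AlmostCommutative⟶ almostRing
    morphism = record
      { ⟦_⟧ = ⟦_⟧
      ; +-homo = λ p@(a , b) r@(c , d) → via (p ⊕ r)
          (trans (difference-cancel (a ℕ.+ c , b ℕ.+ d)) (trans (+-cong (×-homo-+ 1# a c) (-‿cong (×-homo-+ 1# b d))) (difference-+ _ _ _ _)))
          (+-cong (⟦⟧≈ p) (⟦⟧≈ r))
      ; *-homo = λ p@(a , b) r@(c , d) → via (p ⊛ r) (trans (difference-cancel (a ℕ.* c ℕ.+ b ℕ.* d , a ℕ.* d ℕ.+ b ℕ.* c)) (trans
          (+-cong (trans (×-homo-+ 1# (a ℕ.* c) (b ℕ.* d)) (+-cong (×1-homo-* a c) (×1-homo-* b d)))
                  (-‿cong (trans (×-homo-+ 1# (a ℕ.* d) (b ℕ.* c)) (+-cong (×1-homo-* a d) (×1-homo-* b c)))))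
          (difference-* _ _ _ _))) (*-cong (⟦⟧≈ p) (⟦⟧≈ r))
      ; -‿homo = λ p@(a , b) → via (b , a) (trans (+-comm _ _)
          (trans (+-congˡ (sym (⁻¹-involutive _))) (⁻¹-∙-comm _ _))) (-‿cong (⟦⟧≈ p))
      ; 0-homo = refl
      ; 1-homo = refl
      }
      where
      open RawRing differences using () renaming (_+_ to _⊕_; _*_ to _⊛_)
      via : ∀ p {x y} → difference p ≈ x → y ≈ x → ⟦ p ⟧ ≈ y
      via p e e′ = trans (⟦⟧≈ p) (trans e (sym e′))

    decide : ∀ x y → Maybe (⟦ x ⟧ ≈ ⟦ y ⟧)
    decide (a , b) (c , d) with a ℕ.≟ c | b ℕ.≟ d
    ... | yes ≡.refl | yes ≡.refl = just refl
    ... | _          | _          = nothing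

  open Algebra.Solver.Ring differences almostRing morphism decide
    using (solve; _:=_; con; _:+_; _:*_; _:-_; :-_; Polynomial)

  :0 :1 : ∀ {n} → Polynomial n
  :0 = con (0 , 0)
  :1 = con (1 , 0)


  -- Sums and products over lists.

  module _ {a} {A : Set a} where

    ∑ ∏ : List A → (A → Carrier) → Carrier
    ∑ xs f = sumL (map f xs)
    ∏ xs f = prodL (map f xs)

    ∑-cong : ∀ xs {f g : A → Carrier} → (∀ {x} → x ∈ xs → f x ≈ g x) → ∑ xs f ≈ ∑ xs g
    ∑-cong []       e = refl
    ∑-cong (x ∷ xs) e = +-cong (e (here ≡.refl)) (∑-cong xs (e ∘ there))

    ∏-cong : ∀ xs {f g : A → Carrier} → (∀ {x} → x ∈ xs → f x ≈ g x) → ∏ xs f ≈ ∏ xs g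
    ∏-cong []       e = refl
    ∏-cong (x ∷ xs) e = *-cong (e (here ≡.refl)) (∏-cong xs (e ∘ there))

    ∑-↭ : ∀ {xs ys} (f : A → Carrier) → xs ↭ ys → ∑ xs f ≈ ∑ ys f
    ∑-↭ f Perm.refl = refl
    ∑-↭ f (prep x p) = +-congˡ (∑-↭ f p)
    ∑-↭ f (swap x y p) = trans (+-congˡ (+-congˡ (∑-↭ f p)))
      (solve 3 (λ a b s → a :+ (b :+ s) := b :+ (a :+ s)) refl _ _ _)
    ∑-↭ f (Perm.trans p r) = trans (∑-↭ f p) (∑-↭ f r)

    ∏-↭ : ∀ {xs ys} (f : A → Carrier) → xs ↭ ys → ∏ xs f ≈ ∏ ys f
    ∏-↭ f Perm.refl = refl
    ∏-↭ f (prep x p) = *-congˡ (∏-↭ f p)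
    ∏-↭ f (swap x y p) = trans (*-congˡ (*-congˡ (∏-↭ f p)))
      (solve 3 (λ a b s → a :* (b :* s) := b :* (a :* s)) refl _ _ _)
    ∏-↭ f (Perm.trans p r) = trans (∏-↭ f p) (∏-↭ f r)

    ∑-++ : ∀ xs {ys} (f : A → Carrier) → ∑ (xs ++ ys) f ≈ ∑ xs f + ∑ ys f
    ∑-++ []       f = sym (+-identityˡ _)
    ∑-++ (x ∷ xs) f = trans (+-congˡ (∑-++ xs f)) (sym (+-assoc _ _ _))

    ∏-++ : ∀ xs {ys} (f : A → Carrier) → ∏ (xs ++ ys) f ≈ ∏ xs f * ∏ ys f
    ∏-++ []       f = sym (*-identityˡ _)
    ∏-++ (x ∷ xs) f = trans (*-congˡ (∏-++ xs f)) (sym (*-assoc _ _ _))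

    ∑-+ : ∀ xs (f g : A → Carrier) → ∑ xs (λ x → f x + g x) ≈ ∑ xs f + ∑ xs g
    ∑-+ []       f g = sym (+-identityˡ _)
    ∑-+ (x ∷ xs) f g = trans (+-congˡ (∑-+ xs f g))
      (solve 4 (λ a b s t → (a :+ b) :+ (s :+ t) := (a :+ s) :+ (b :+ t)) refl _ _ _ _)

    ∏-* : ∀ xs (f g : A → Carrier) → ∏ xs (λ x → f x * g x) ≈ ∏ xs f * ∏ xs g
    ∏-* []       f g = sym (*-identityˡ _)
    ∏-* (x ∷ xs) f g = trans (*-congˡ (∏-* xs f g))
      (solve 4 (λ a b s t → (a :* b) :* (s :* t) := (a :* s) :* (b :* t)) refl _ _ _ _)

    ∑-*ˡ : ∀ xs c (f : A → Carrier) → ∑ xs (λ x → c * f x) ≈ c * ∑ xs f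
    ∑-*ˡ []       c f = sym (zeroʳ c)
    ∑-*ˡ (x ∷ xs) c f = trans (+-congˡ (∑-*ˡ xs c f)) (sym (distribˡ _ _ _))

    ∑-zero : ∀ xs {f : A → Carrier} → (∀ {x} → x ∈ xs → f x ≈ 0#) → ∑ xs f ≈ 0#
    ∑-zero []       e = refl
    ∑-zero (x ∷ xs) e = trans (+-cong (e (here ≡.refl)) (∑-zero xs (e ∘ there))) (+-identityˡ _)

    ∏-const : ∀ xs c → ∏ xs (λ (_ : A) → c) ≈ c ^ length xs
    ∏-const []       c = refl
    ∏-const (x ∷ xs) c = *-congˡ (∏-const xs c)

    ∏-one : ∀ xs {f : A → Carrier} → (∀ {x} → x ∈ xs → f x ≈ 1#) → ∏ xs f ≈ 1#
    ∏-one []       e = refl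
    ∏-one (x ∷ xs) e = trans (*-cong (e (here ≡.refl)) (∏-one xs (e ∘ there))) (*-identityˡ _)

  module _ {a b} {A : Set a} {B : Set b} where

    ∑-swap : ∀ xs ys (f : A → B → Carrier) →
             ∑ xs (λ x → ∑ ys (f x)) ≈ ∑ ys (λ y → ∑ xs (λ x → f x y))
    ∑-swap []       ys f = sym (∑-zero ys (λ _ → refl))
    ∑-swap (x ∷ xs) ys f = trans (+-congˡ (∑-swap xs ys f)) (sym (∑-+ ys (f x) _))

    ∑-map : ∀ (g : A → B) xs (f : B → Carrier) → ∑ (map g xs) f ≡ ∑ xs (f ∘ g)
    ∑-map g xs f = ≡.cong sumL (≡.sym (List.map-∘ xs))

    ∏-map : ∀ (g : A → B) xs (f : B → Carrier) → ∏ (map g xs) f ≡ ∏ xs (f ∘ g)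
    ∏-map g xs f = ≡.cong prodL (≡.sym (List.map-∘ xs))

  -- Inverses and the enumeration of the field.

  _≉0 : Carrier → Set ℓ
  x ≉0 = ¬ (x ≈ 0#)

  infix 9 _⁻

  -- Junk value: 0# ⁻ ≈ 1#, so that products of inverses may run over indices with a vanishing factor.
  _⁻ : Carrier → Carrier
  x ⁻ with x ≟ 0#
  ... | yes _   = 1#
  ... | no  x≉0 = proj₁ (inverse x x≉0)

  *-inverseʳ : ∀ {x} → x ≉0 → x * x ⁻ ≈ 1#
  *-inverseʳ {x} x≉0 with x ≟ 0#
  ... | yes x≈0 = ⊥-elim (x≉0 x≈0)
  ... | no  x≉0 = proj₂ (inverse x x≉0)

  ⁻-zero : ∀ {x} → x ≈ 0# → x ⁻ ≈ 1#
  ⁻-zero {x} x≈0 with x ≟ 0#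
  ... | yes _   = refl
  ... | no  x≉0 = ⊥-elim (x≉0 x≈0)

  unit≉0 : ∀ {x y} → x * y ≈ 1# → x ≉0
  unit≉0 {x} {y} e x≈0 = 0≉1 (trans (sym (zeroˡ y)) (trans (*-congʳ (sym x≈0)) e))

  1≉0 : 1# ≉0
  1≉0 e = 0≉1 (sym e)

  *-cancelˡ : ∀ {x y z} → x ≉0 → x * y ≈ x * z → y ≈ z
  *-cancelˡ {x} {y} {z} x≉0 e = begin
    y                ≈⟨ sym (*-identityˡ y) ⟩
    1# * y           ≈⟨ *-congʳ (sym (*-inverseʳ x≉0)) ⟩
    (x * x ⁻) * y    ≈⟨ solve 3 (λ x i y → (x :* i) :* y := i :* (x :* y)) refl _ _ _ ⟩
    x ⁻ * (x * y)    ≈⟨ *-congˡ e ⟩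
    x ⁻ * (x * z)    ≈⟨ solve 3 (λ x i y → i :* (x :* y) := (x :* i) :* y) refl _ _ _ ⟩
    (x * x ⁻) * z    ≈⟨ *-congʳ (*-inverseʳ x≉0) ⟩
    1# * z           ≈⟨ *-identityˡ z ⟩
    z                ∎

  ≉0-* : ∀ {x y} → x ≉0 → y ≉0 → (x * y) ≉0
  ≉0-* x≉0 y≉0 e = y≉0 (*-cancelˡ x≉0 (trans e (sym (zeroʳ _))))

  ⁻-unique : ∀ {x y} → x * y ≈ 1# → x ⁻ ≈ y
  ⁻-unique e = *-cancelˡ (unit≉0 e) (trans (*-inverseʳ (unit≉0 e)) (sym e))

  ⁻-cong : ∀ {x y} → x ≈ y → x ⁻ ≈ y ⁻
  ⁻-cong {x} {y} e with y ≟ 0#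
  ... | yes y≈0 = ⁻-zero (trans e y≈0)
  ... | no  y≉0 = ⁻-unique (trans (*-congʳ e) (proj₂ (inverse y y≉0)))

  ⁻-≉0 : ∀ x → (x ⁻) ≉0
  ⁻-≉0 x with x ≟ 0#
  ... | yes _   = 1≉0
  ... | no  x≉0 = unit≉0 (trans (*-comm _ _) (proj₂ (inverse x x≉0)))

  ⁻-* : ∀ {x y} → x ≉0 → y ≉0 → (x * y) ⁻ ≈ x ⁻ * y ⁻
  ⁻-* x≉0 y≉0 = ⁻-unique (trans
    (solve 4 (λ x y i j → (x :* y) :* (i :* j) := (x :* i) :* (y :* j)) refl _ _ _ _)
    (trans (*-cong (*-inverseʳ x≉0) (*-inverseʳ y≉0)) (*-identityˡ _)))

  ∏-≉0 : ∀ {a} {A : Set a} xs {f : A → Carrier} → (∀ {x} → x ∈ xs → f x ≉0) → ∏ xs f ≉0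
  ∏-≉0 []       nz = 1≉0
  ∏-≉0 (x ∷ xs) nz = ≉0-* (nz (here ≡.refl)) (∏-≉0 xs (nz ∘ there))

  ∏-inverseʳ : ∀ {a} {A : Set a} xs {f : A → Carrier} → (∀ {x} → x ∈ xs → f x ≉0) →
               ∏ xs f * ∏ xs (λ x → f x ⁻) ≈ 1#
  ∏-inverseʳ xs nz = trans (sym (∏-* xs _ _)) (∏-one xs (λ x∈ → *-inverseʳ (nz x∈)))

  -≈0⇒≈ : ∀ {x y} → x - y ≈ 0# → x ≈ y
  -≈0⇒≈ {x} {y} e = begin
    x            ≈⟨ solve 2 (λ x y → x := (x :- y) :+ y) refl x y ⟩
    (x - y) + y  ≈⟨ +-congʳ e ⟩
    0# + y       ≈⟨ +-identityˡ y ⟩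
    y            ∎

  index : Carrier → Fin q
  index x = proj₁ (enum-surj x)

  enum-index : ∀ x → enum (index x) ≈ x
  enum-index x = proj₂ (enum-surj x)

  index-injective : ∀ {x y} → index x ≡ index y → x ≈ y
  index-injective {x} {y} e = trans (sym (enum-index x)) (trans (reflexive (≡.cong enum e)) (enum-index y))

  enum-≉ : ∀ {i j} → i ≢ j → (enum i - enum j) ≉0
  enum-≉ i≢j e = i≢j (enum-inj _ _ (-≈0⇒≈ e))

  -- Divided differences

  -- For distinct nodes this is the classical divided difference: the factor at `z = a` is the junk
  -- inverse `1#`, so the product effectively runs over `z ≠ a`.
  divDiff : (Fin q → Carrier) → List (Fin q) → Carrier
  divDiff g xs = ∑ xs (λ a → g a * ∏ xs (λ z → (enum a - enum z) ⁻))

  divDiff-cong : ∀ xs {g h} → (∀ a → g a ≈ h a) → divDiff g xs ≈ divDiff h xs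
  divDiff-cong xs e = ∑-cong xs (λ _ → *-congʳ (e _))

  divDiff-linear : ∀ xs c g h → divDiff (λ a → g a + c * h a) xs ≈ divDiff g xs + c * divDiff h xs
  divDiff-linear xs c g h = trans
    (∑-cong xs (λ _ → solve 4 (λ g c h p → (g :+ c :* h) :* p := g :* p :+ c :* (h :* p)) refl _ _ _ _))
    (trans (∑-+ xs _ _) (+-congˡ (∑-*ˡ xs c _)))

  divDiff-↭ : ∀ {xs ys} g → xs ↭ ys → divDiff g xs ≈ divDiff g ys
  divDiff-↭ {xs} g p = trans (∑-cong xs (λ _ → *-congˡ (∏-↭ _ p))) (∑-↭ _ p)

  -- The factor `a - x` kills the summand at `x` and cancels the denominator `a - x` in all the
  -- others.
  divDiff-remove : ∀ {x xs} g → Unique (x ∷ xs) →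
                   divDiff (λ a → (enum a - enum x) * g a) (x ∷ xs) ≈ divDiff g xs
  divDiff-remove {x} {xs} g (x∉ ∷ _) = begin
    ((enum x - enum x) * g x) * P x + ∑ xs (λ a → ((enum a - enum x) * g a) * P a)
      ≈⟨ +-cong (solve 3 (λ x g p → ((x :- x) :* g) :* p := :0) refl _ _ _) (∑-cong xs step) ⟩
    0# + divDiff g xs  ≈⟨ +-identityˡ _ ⟩
    divDiff g xs       ∎
    where
    P : Fin q → Carrier
    P a = ∏ (x ∷ xs) (λ z → (enum a - enum z) ⁻)
    step : ∀ {a} → a ∈ xs → ((enum a - enum x) * g a) * P a ≈ g a * ∏ xs (λ z → (enum a - enum z) ⁻)
    step a∈ = trans
      (solve 4 (λ d i g p → (d :* g) :* (i :* p) := (d :* i) :* (g :* p)) refl _ _ _ _)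
      (trans (*-congʳ (*-inverseʳ (enum-≉ (All.lookup x∉ a∈ ∘ ≡.sym)))) (*-identityˡ _))

  -- Write the constant `y - x` as `(a - x) - (a - y)`. Removing the node `x` or the node `y` leaves
  -- two divided differences of `1#` with one node fewer; these agree, both being `1#` on a single
  -- node and `0#` by induction otherwise.
  divDiff-one : ∀ {x y} xs → Unique (x ∷ y ∷ xs) → divDiff (λ _ → 1#) (x ∷ y ∷ xs) ≈ 0#
  divDiff-one {x} {y} xs u@((x≢y ∷ x∉) ∷ (y∉ ∷ uxs)) = *-cancelˡ (enum-≉ (x≢y ∘ ≡.sym)) (begin
    (enum y - enum x) * D                                            ≈⟨ sym (+-identityˡ _) ⟩
    0# + (enum y - enum x) * D                                       ≈⟨ +-congʳ (sym (∑-zero (x ∷ y ∷ xs) (λ _ → zeroˡ _))) ⟩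
    divDiff (λ _ → 0#) l + (enum y - enum x) * D                     ≈⟨ sym (divDiff-linear l _ _ _) ⟩
    divDiff (λ _ → 0# + (enum y - enum x) * 1#) l
      ≈⟨ divDiff-cong l (λ a → solve 3 (λ a x y → :0 :+ (y :- x) :* :1 := (a :- x) :* :1 :+ (:- :1) :* ((a :- y) :* :1)) refl (enum a) (enum x) (enum y)) ⟩
    divDiff (λ a → (enum a - enum x) * 1# + (- 1#) * ((enum a - enum y) * 1#)) l
      ≈⟨ divDiff-linear l _ _ _ ⟩
    divDiff (λ a → (enum a - enum x) * 1#) l + (- 1#) * divDiff (λ a → (enum a - enum y) * 1#) l
      ≈⟨ +-cong (divDiff-remove _ u) (*-congˡ (trans (divDiff-↭ {l} {y ∷ x ∷ xs} _ (swap x y ↭-refl)) (divDiff-remove _ u′))) ⟩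
    divDiff (λ _ → 1#) (y ∷ xs) + (- 1#) * divDiff (λ _ → 1#) (x ∷ xs) ≈⟨ +-cong (proj₁ both) (*-congˡ (proj₂ both)) ⟩
    s + (- 1#) * s      ≈⟨ solve 2 (λ s d → s :+ (:- :1) :* s := d :* :0) refl s (enum y - enum x) ⟩
    (enum y - enum x) * 0#                                           ∎)
    where
    l = x ∷ y ∷ xs
    D = divDiff (λ _ → 1#) l
    u′ : Unique (y ∷ x ∷ xs)
    u′ = (x≢y ∘ ≡.sym ∷ y∉) ∷ (x∉ ∷ uxs)
    common : ∀ zs → Unique (x ∷ zs) → Unique (y ∷ zs) → Σ Carrier λ s →
             divDiff (λ _ → 1#) (y ∷ zs) ≈ s × divDiff (λ _ → 1#) (x ∷ zs) ≈ s
    common []       ux uy = 1# , single y , single x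
      where
      single : ∀ x → divDiff (λ _ → 1#) (x ∷ []) ≈ 1#
      single x = trans (+-identityʳ _) (trans (*-identityˡ _) (trans (*-identityʳ _) (⁻-zero (-‿inverseʳ _))))
    common (z ∷ zs) ux uy = 0# , divDiff-one zs uy , divDiff-one zs ux
    s = proj₁ (common xs (x∉ ∷ uxs) (y∉ ∷ uxs))
    both = proj₂ (common xs (x∉ ∷ uxs) (y∉ ∷ uxs))

  monic : List (Fin q) → Fin q → Carrier
  monic ts a = ∏ ts (λ t → enum a - enum t)

  -- Split `a - t` as `(a - x) + (x - t)`: the first part removes the node `x`, the second is
  -- constant in `a`.
  divDiff-monic-step : ∀ {x xs} t ts → Unique (x ∷ xs) →
    divDiff (monic (t ∷ ts)) (x ∷ xs) ≈ divDiff (monic ts) xs + (enum x - enum t) * divDiff (monic ts) (x ∷ xs)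
  divDiff-monic-step {x} {xs} t ts u = begin
    divDiff (monic (t ∷ ts)) (x ∷ xs)
      ≈⟨ divDiff-cong (x ∷ xs) (λ a → solve 4 (λ a x t m → (a :- t) :* m := (a :- x) :* m :+ (x :- t) :* m) refl (enum a) (enum x) (enum t) (monic ts a)) ⟩
    divDiff (λ a → (enum a - enum x) * monic ts a + (enum x - enum t) * monic ts a) (x ∷ xs)
      ≈⟨ divDiff-linear (x ∷ xs) _ _ _ ⟩
    divDiff (λ a → (enum a - enum x) * monic ts a) (x ∷ xs) + (enum x - enum t) * divDiff (monic ts) (x ∷ xs)
      ≈⟨ +-congʳ (divDiff-remove _ u) ⟩
    divDiff (monic ts) xs + (enum x - enum t) * divDiff (monic ts) (x ∷ xs) ∎

  divDiff-low : ∀ ts {xs} → Unique xs → suc (length ts) ℕ.< length xs → divDiff (monic ts) xs ≈ 0#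
  divDiff-low []       {x ∷ y ∷ xs} u _ = divDiff-one xs u
  divDiff-low []       {x ∷ []} u (ℕ.s≤s ())
  divDiff-low (t ∷ ts) {x ∷ xs} u@(_ ∷ uxs) (ℕ.s≤s lt) = begin
    divDiff (monic (t ∷ ts)) (x ∷ xs)                                       ≈⟨ divDiff-monic-step t ts u ⟩
    divDiff (monic ts) xs + (enum x - enum t) * divDiff (monic ts) (x ∷ xs)
      ≈⟨ +-cong (divDiff-low ts uxs lt) (*-congˡ (divDiff-low ts u (ℕ.m<n⇒m<1+n lt))) ⟩
    0# + (enum x - enum t) * 0#                                             ≈⟨ solve 1 (λ d → :0 :+ d :* :0 := :0) refl _ ⟩
    0#                                                                      ∎

  -- In the recursion one summand loses a root and a node and is again of this kind, while the other
  -- loses only a root and vanishes by `divDiff-low`.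
  divDiff-leading : ∀ ts {xs} → Unique xs → suc (length ts) ≡ length xs → divDiff (monic ts) xs ≈ 1#
  divDiff-leading []       {x ∷ []} u _ =
    trans (+-identityʳ _) (trans (*-identityˡ _) (trans (*-identityʳ _) (⁻-zero (-‿inverseʳ _))))
  divDiff-leading (t ∷ ts) {x ∷ xs} u@(_ ∷ uxs) e = begin
    divDiff (monic (t ∷ ts)) (x ∷ xs)                                       ≈⟨ divDiff-monic-step t ts u ⟩
    divDiff (monic ts) xs + (enum x - enum t) * divDiff (monic ts) (x ∷ xs)
      ≈⟨ +-cong (divDiff-leading ts uxs (ℕ.suc-injective e)) (*-congˡ (divDiff-low ts u (ℕ.≤-reflexive e))) ⟩
    1# + (enum x - enum t) * 0#                                             ≈⟨ solve 1 (λ d → :1 :+ d :* :0 := :1) refl _ ⟩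
    1#                                                                      ∎

  -- Fermat and Wilson

  module _ (φ : Carrier → Carrier) (φ-inj : ∀ {x y} → φ x ≈ φ y → x ≈ y)
           (g : Carrier → Carrier) (g-cong : ∀ {x y} → x ≈ y → g x ≈ g y) where
    private
      π : Fin q → Fin q
      π i = index (φ (enum i))

      π-↭ : map π (allFin q) ↭ allFin q
      π-↭ = map-injective-↭ π (λ e → enum-inj _ _ (φ-inj (index-injective e)))

    ∑-reindex : ∑ (allFin q) (λ i → g (φ (enum i))) ≈ ∑ (allFin q) (λ i → g (enum i))
    ∑-reindex = trans (∑-cong (allFin q) (λ _ → g-cong (sym (enum-index _))))
      (trans (reflexive (≡.sym (∑-map π (allFin q) _))) (∑-↭ _ π-↭))

    ∏-reindex : ∏ (allFin q) (λ i → g (φ (enum i))) ≈ ∏ (allFin q) (λ i → g (enum i))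
    ∏-reindex = trans (∏-cong (allFin q) (λ _ → g-cong (sym (enum-index _))))
      (trans (reflexive (≡.sym (∏-map π (allFin q) _))) (∏-↭ _ π-↭))

  zeroIndex : Fin q
  zeroIndex = index 0#

  units : List (Fin q)
  units = complement (zeroIndex ∷ [])

  allFin-units : allFin q ↭ zeroIndex ∷ units
  allFin-units = ↭-sym (++-complement-↭ ([] ∷ []))

  length-units : suc (length units) ≡ q
  length-units = length-complement {xs = zeroIndex ∷ []} ([] ∷ [])

  units-≉0 : ∀ {i} → i ∈ units → enum i ≉0
  units-≉0 i∈ e = ∈-complement⁻ i∈ (here (enum-inj _ _ (trans e (sym (enum-index 0#)))))

  -- The inverse of the product of all nonzero elements. The junk value lets it run over the whole
  -- field, so that bijections of the field may reindex it.
  ∏-inverses : Carrier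
  ∏-inverses = ∏ (allFin q) (λ i → enum i ⁻)

  ∏-inverses-units : ∏-inverses ≈ ∏ units (λ i → enum i ⁻)
  ∏-inverses-units = trans (∏-↭ _ allFin-units) (trans (*-congʳ (⁻-zero (enum-index 0#))) (*-identityˡ _))

  -- Multiplication by `x ⁻` permutes the field, hence preserves `∏-inverses`; but it also
  -- multiplies each of the factors over `units` by `x`.
  fermat : ∀ {x} → x ≉0 → x ^ length units ≈ 1#
  fermat {x} x≉0 = *-cancelˡ (∏-≉0 units {λ i → enum i ⁻} (λ _ → ⁻-≉0 _)) (begin
    Q * x ^ length units                                  ≈⟨ *-comm _ _ ⟩
    x ^ length units * Q                                  ≈⟨ *-congʳ (sym (∏-const units x)) ⟩
    ∏ units (λ _ → x) * Q                                 ≈⟨ sym (∏-* units _ _) ⟩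
    ∏ units (λ i → x * enum i ⁻)                          ≈⟨ ∏-cong units (λ i∈ → sym (scaled i∈)) ⟩
    ∏ units (λ i → (x ⁻ * enum i) ⁻)                      ≈⟨ sym (*-identityˡ _) ⟩
    1# * ∏ units (λ i → (x ⁻ * enum i) ⁻)                 ≈⟨ *-congʳ (sym (⁻-zero (trans (*-congˡ (enum-index 0#)) (zeroʳ _)))) ⟩
    ∏ (zeroIndex ∷ units) (λ i → (x ⁻ * enum i) ⁻)        ≈⟨ sym (∏-↭ _ allFin-units) ⟩
    ∏ (allFin q) (λ i → (x ⁻ * enum i) ⁻)                 ≈⟨ ∏-reindex (x ⁻ *_) (*-cancelˡ (⁻-≉0 x)) _⁻ ⁻-cong ⟩
    ∏-inverses                                            ≈⟨ ∏-inverses-units ⟩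
    Q                                                     ≈⟨ sym (*-identityʳ _) ⟩
    Q * 1#                                                ∎)
    where
    Q = ∏ units (λ i → enum i ⁻)
    scaled : ∀ {i} → i ∈ units → (x ⁻ * enum i) ⁻ ≈ x * enum i ⁻
    scaled i∈ = trans (⁻-* (⁻-≉0 x) (units-≉0 i∈)) (*-congʳ (⁻-unique (trans (*-comm _ _) (*-inverseʳ x≉0))))

  ^-suc-q : ∀ {x} → x ≉0 → x ^ suc q ≈ x * x
  ^-suc-q {x} x≉0 = begin
    x ^ suc q                      ≡⟨ ≡.cong (λ r → x ^ suc r) (≡.sym length-units) ⟩
    x * (x * x ^ length units)     ≈⟨ *-congˡ (*-congˡ (fermat x≉0)) ⟩
    x * (x * 1#)                   ≈⟨ *-congˡ (*-identityʳ x) ⟩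
    x * x                          ∎

  -- Translation by `1#` does not change the sum of all field elements, so `1#` summed over the
  -- whole field is `0#`.
  ∑-one-units : ∑ units (λ _ → 1#) ≈ - 1#
  ∑-one-units = begin
    ∑ units (λ _ → 1#)                        ≈⟨ solve 1 (λ s → s := (:1 :+ s) :- :1) refl _ ⟩
    (1# + ∑ units (λ _ → 1#)) - 1#            ≈⟨ +-congʳ (sym (∑-↭ _ allFin-units)) ⟩
    ∑ (allFin q) (λ _ → 1#) - 1#              ≈⟨ +-congʳ all≈0 ⟩
    0# - 1#                                   ≈⟨ +-identityˡ _ ⟩
    - 1#                                      ∎
    where
    S = ∑ (allFin q) enum
    all≈0 : ∑ (allFin q) (λ _ → 1#) ≈ 0#
    all≈0 = begin
      ∑ (allFin q) (λ _ → 1#)            ≈⟨ solve 2 (λ o s → o := (o :+ s) :- s) refl _ S ⟩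
      (∑ (allFin q) (λ _ → 1#) + S) - S  ≈⟨ +-congʳ (sym (∑-+ (allFin q) _ _)) ⟩
      ∑ (allFin q) (λ i → 1# + enum i) - S
        ≈⟨ +-congʳ (∑-reindex (1# +_) (λ {x} {y} e → trans (solve 1 (λ x → x := (:1 :+ x) :- :1) refl x) (trans (+-congʳ e) (solve 1 (λ x → (:1 :+ x) :- :1 := x) refl y))) (λ x → x) (λ e → e)) ⟩
      S - S                              ≈⟨ -‿inverseʳ S ⟩
      0#                                 ∎

  ∏-differences : ∀ x → ∏ (allFin q) (λ i → (x - enum i) ⁻) ≈ ∏-inverses
  ∏-differences x = ∏-reindex (λ y → x - y)
    (λ {y} {z} e → trans (solve 2 (λ x y → y := x :- (x :- y)) refl x y)
      (trans (+-congˡ (-‿cong e)) (solve 2 (λ x y → x :- (x :- y) := y) refl x z)))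
    _⁻ ⁻-cong

  -- The leading coefficient of x ^ (q - 1) is read off by the divided difference over the whole field.
  wilson : ∏-inverses ≈ - 1#
  wilson = begin
    ∏-inverses                                    ≈⟨ solve 1 (λ w → w := :- ((:- :1) :* w)) refl _ ⟩
    - (- 1# * ∏-inverses)                         ≈⟨ -‿cong (sym powers) ⟩
    - divDiff (monic ts) (allFin q)               ≈⟨ -‿cong (divDiff-leading ts (Unique.allFin⁺ q) len) ⟩
    - 1#                                          ∎
    where
    -- The power of exponent q - 1 as a monic polynomial: the root zero with multiplicity q - 1.
    ts = replicate (length units) zeroIndex
    len : suc (length ts) ≡ length (allFin q)
    len = ≡.trans (≡.cong suc (List.length-replicate (length units)))
            (≡.trans length-units (≡.sym (List.length-tabulate {n = q} (λ i → i))))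
    monic-replicate : ∀ r a → monic (replicate r zeroIndex) a ≈ enum a ^ r
    monic-replicate zero    a = refl
    monic-replicate (suc r) a = *-cong
      (trans (+-congˡ (-‿cong (enum-index 0#))) (solve 1 (λ a → a :- :0 := a) refl _)) (monic-replicate r a)
    -- The exponent must be positive for the power of zero to vanish; the unit `1#` guarantees it.
    0^ : ∀ us → index 1# ∈ us → enum zeroIndex ^ length us ≈ 0#
    0^ (_ ∷ us) _ = trans (*-congʳ (enum-index 0#)) (zeroˡ _)
    1∈ : index 1# ∈ units
    1∈ = ∈-complement⁺ λ { (here e) → 0≉1 (sym (index-injective e)) }
    -- Over the whole field all nodes have the same product of inverse differences, so only the
    -- power sum remains, and by `fermat` each unit contributes `1#` to it.
    powers : divDiff (monic ts) (allFin q) ≈ - 1# * ∏-inverses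
    powers = begin
      divDiff (monic ts) (allFin q)
        ≈⟨ ∑-cong (allFin q) (λ _ → trans (*-cong (monic-replicate (length units) _) (∏-differences _)) (*-comm _ _)) ⟩
      ∑ (allFin q) (λ a → ∏-inverses * enum a ^ length units)
        ≈⟨ ∑-*ˡ (allFin q) _ _ ⟩
      ∏-inverses * ∑ (allFin q) (λ a → enum a ^ length units)
        ≈⟨ *-congˡ (trans (∑-↭ _ allFin-units) (+-cong (0^ units 1∈) (∑-cong units (λ i∈ → fermat (units-≉0 i∈))))) ⟩
      ∏-inverses * (0# + ∑ units (λ _ → 1#))
        ≈⟨ *-congˡ (trans (+-identityˡ _) ∑-one-units) ⟩
      ∏-inverses * - 1#  ≈⟨ *-comm _ _ ⟩
      - 1# * ∏-inverses  ∎

  -- By Wilson, ∏_{z ∈ zs} (a - z)⁻¹ = - ∏_{t ∉ zs} (a - t), a monic polynomial in a of degree length xs - 1.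
  affine-identity : ∀ {zs xs} → Unique zs → Unique xs → (∀ {a} → a ∈ xs → a ∈ zs) →
    length zs ℕ.+ length xs ≡ suc q →
    1# + ∑ xs (λ a → ∏ zs (λ z → (enum a - enum z) ⁻) * ∏ xs (λ z → (enum a - enum z) ⁻)) ≈ 0#
  affine-identity {zs} {xs} uz ux sub len = begin
    1# + ∑ xs (λ a → R zs a * R xs a)                 ≈⟨ +-congˡ (∑-cong xs (λ a∈ → trans (*-congʳ (complementary a∈)) (*-assoc _ _ _))) ⟩
    1# + ∑ xs (λ a → - 1# * (monic ts a * R xs a))    ≈⟨ +-congˡ (∑-*ˡ xs _ _) ⟩
    1# + - 1# * divDiff (monic ts) xs                 ≈⟨ +-congˡ (*-congˡ (divDiff-leading ts ux lens)) ⟩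
    1# + - 1# * 1#                                    ≈⟨ solve 0 (:1 :+ (:- :1) :* :1 := :0) refl ⟩
    0#                                                ∎
    where
    R : List (Fin q) → Fin q → Carrier
    R ys a = ∏ ys (λ z → (enum a - enum z) ⁻)
    ts = complement zs
    lens : suc (length ts) ≡ length xs
    lens = ℕ.+-cancelˡ-≡ (length zs) _ _ (≡.trans (ℕ.+-suc _ _)
             (≡.trans (≡.cong suc (length-complement uz)) (≡.sym len)))
    complementary : ∀ {a} → a ∈ xs → R zs a ≈ - 1# * monic ts a
    complementary {a} a∈ = begin
      R zs a                             ≈⟨ sym (*-identityʳ _) ⟩
      R zs a * 1#                        ≈⟨ *-congˡ (sym (∏-inverseʳ ts (λ t∈ → enum-≉ λ { ≡.refl → ∈-complement⁻ t∈ (sub a∈) }))) ⟩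
      R zs a * (monic ts a * R ts a)     ≈⟨ solve 3 (λ z m t → z :* (m :* t) := (z :* t) :* m) refl _ _ _ ⟩
      (R zs a * R ts a) * monic ts a     ≈⟨ *-congʳ (trans (sym (∏-++ zs _)) (∏-↭ _ (++-complement-↭ uz))) ⟩
      R (allFin q) a * monic ts a        ≈⟨ *-congʳ (trans (∏-differences (enum a)) wilson) ⟩
      - 1# * monic ts a                  ∎

  -- The identity on the projective line.

  -- Meant for products whose factorisation fails at one index, the diagonal one, where an inverse
  -- takes its junk value; `k` is the correction.
  ∏-adjust : ∀ {a} {A : Set a} {xs} {f g : A → Carrier} {x k} → Unique xs → x ∈ xs → f x ≈ k * g x →
             (∀ {y} → y ∈ xs → y ≢ x → f y ≈ g y) → ∏ xs f ≈ k * ∏ xs g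
  ∏-adjust {xs = _ ∷ xs} (x∉ ∷ u) (here ≡.refl) e e′ = trans
    (*-cong e (∏-cong xs (λ y∈ → e′ (there y∈) (All.lookup x∉ y∈ ∘ ≡.sym)))) (*-assoc _ _ _)
  ∏-adjust (x∉ ∷ u) (there x∈) e e′ = trans
    (*-cong (e′ (here ≡.refl) (All.lookup x∉ x∈)) (∏-adjust u x∈ e (e′ ∘ there)))
    (solve 3 (λ a k p → a :* (k :* p) := k :* (a :* p)) refl _ _ _)

  -- An alternating form on a plane, evaluated on representatives of distinct projective points:
  -- the point o is at infinity and z ∈ zs is s z · (t z , 1).
  module ProjectiveLine
    {i} {I : Set i} (⟨_,_⟩ : I → I → Carrier) (ε : I → Carrier) (o : I) (zs xs : List I)
    (κ : Carrier) (s t : I → Carrier)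
    (uz : Unique zs) (ux : Unique xs) (sub : ∀ {a} → a ∈ xs → a ∈ zs)
    (len : length zs ℕ.+ length xs ≡ suc q)
    (κ≉0 : κ ≉0) (s≉0 : ∀ {z} → z ∈ zs → s z ≉0)
    (t-inj : ∀ {y z} → y ∈ zs → z ∈ zs → t y ≈ t z → y ≡ z)
    (ε² : ∀ a → ε a * ε a ≈ 1#)
    (⟨⟩-finite : ∀ {z a} → z ∈ zs → a ∈ zs → ⟨ z , a ⟩ ≈ κ * (s z * (s a * (t a - t z))))
    (⟨z,o⟩ : ∀ {z} → z ∈ zs → ⟨ z , o ⟩ ≈ s z) (⟨o,z⟩ : ∀ {z} → z ∈ zs → ⟨ o , z ⟩ ≈ - s z)
    (⟨o,o⟩ : ⟨ o , o ⟩ ≈ 0#)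
    where

    private
      R : List I → I → Carrier
      R ys a = ∏ ys (λ z → (t a - t z) ⁻)

      S : List I → Carrier
      S ys = ∏ ys (λ z → s z ⁻)

      weight : I → I → Carrier
      weight a z = (ε a * ⟨ z , a ⟩) ⁻

      ε≉0 : ∀ a → ε a ≉0
      ε≉0 a = unit≉0 (ε² a)

      weights-o : ∀ ys → (∀ {y} → y ∈ ys → y ∈ zs) → ∏ ys (weight o) ≈ (ε o ⁻) ^ length ys * S ys
      weights-o ys sub′ = begin
        ∏ ys (weight o)                      ≈⟨ ∏-cong ys (λ y∈ → trans (⁻-cong (*-congˡ (⟨z,o⟩ (sub′ y∈)))) (⁻-* (ε≉0 o) (s≉0 (sub′ y∈)))) ⟩
        ∏ ys (λ z → ε o ⁻ * s z ⁻)           ≈⟨ ∏-* ys _ _ ⟩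
        ∏ ys (λ _ → ε o ⁻) * S ys            ≈⟨ *-congʳ (∏-const ys _) ⟩
        (ε o ⁻) ^ length ys * S ys           ∎

      module _ {a} (a∈zs : a ∈ zs) where
        scale : Carrier
        scale = ε a * (κ * s a)

        scale≉0 : scale ≉0
        scale≉0 = ≉0-* (ε≉0 a) (≉0-* κ≉0 (s≉0 a∈zs))

        t-≉ : ∀ {z} → z ∈ zs → z ≢ a → (t a - t z) ≉0
        t-≉ z∈ z≢a e = z≢a (≡.sym (t-inj a∈zs z∈ (-≈0⇒≈ e)))

        weight-other : ∀ {z} → z ∈ zs → z ≢ a → weight a z ≈ scale ⁻ * (s z ⁻ * (t a - t z) ⁻)
        weight-other {z} z∈ z≢a = begin
          (ε a * ⟨ z , a ⟩) ⁻                           ≈⟨ ⁻-cong (*-congˡ (⟨⟩-finite z∈ a∈zs)) ⟩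
          (ε a * (κ * (s z * (s a * (t a - t z))))) ⁻   ≈⟨ ⁻-cong (solve 5 (λ e k z a d → e :* (k :* (z :* (a :* d))) := (e :* (k :* a)) :* (z :* d)) refl _ _ _ _ _) ⟩
          (scale * (s z * (t a - t z))) ⁻               ≈⟨ ⁻-* scale≉0 (≉0-* (s≉0 z∈) (t-≉ z∈ z≢a)) ⟩
          scale ⁻ * (s z * (t a - t z)) ⁻               ≈⟨ *-congˡ (⁻-* (s≉0 z∈) (t-≉ z∈ z≢a)) ⟩
          scale ⁻ * (s z ⁻ * (t a - t z) ⁻)             ∎

        -- Both `⟨ a , a ⟩` and `t a - t a` vanish and have junk inverse `1#`, so the formula of
        -- `weight-other` is off by exactly `scale * s a` on the diagonal.
        weight-self : weight a a ≈ (scale * s a) * (scale ⁻ * (s a ⁻ * (t a - t a) ⁻))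
        weight-self = begin
          (ε a * ⟨ a , a ⟩) ⁻          ≈⟨ ⁻-zero (trans (*-congˡ (⟨⟩-finite a∈zs a∈zs)) (solve 4 (λ e k a d → e :* (k :* (a :* (a :* (d :- d)))) := :0) refl _ _ _ _)) ⟩
          1#                           ≈⟨ solve 0 (:1 := (:1 :* :1) :* :1) refl ⟩
          (1# * 1#) * 1#               ≈⟨ sym (*-cong (*-cong (*-inverseʳ scale≉0) (*-inverseʳ (s≉0 a∈zs))) (⁻-zero (-‿inverseʳ _))) ⟩
          ((scale * scale ⁻) * (s a * s a ⁻)) * (t a - t a) ⁻
            ≈⟨ solve 5 (λ c i s j d → ((c :* i) :* (s :* j)) :* d := (c :* s) :* (i :* (j :* d))) refl _ _ _ _ _ ⟩
          (scale * s a) * (scale ⁻ * (s a ⁻ * (t a - t a) ⁻)) ∎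

        weights-finite : ∀ {ys} → Unique ys → a ∈ ys → (∀ {y} → y ∈ ys → y ∈ zs) →
          ∏ ys (weight a) ≈ (scale * s a) * ((scale ⁻) ^ length ys * (S ys * R ys a))
        weights-finite {ys} uy a∈ sub′ = begin
          ∏ ys (weight a)                                                       ≈⟨ ∏-adjust uy a∈ weight-self (λ y∈ → weight-other (sub′ y∈)) ⟩
          (scale * s a) * ∏ ys (λ z → scale ⁻ * (s z ⁻ * (t a - t z) ⁻))        ≈⟨ *-congˡ (trans (∏-* ys _ _) (*-cong (∏-const ys _) (∏-* ys _ _))) ⟩
          (scale * s a) * ((scale ⁻) ^ length ys * (S ys * R ys a))             ∎

      term : I → Carrier
      term a = ∏ (o ∷ zs) (weight a) * ∏ (o ∷ xs) (weight a)

      -- The sign `ε o` enters with total exponent q + 1, hence as a square, and drops out.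
      term-o : term o ≈ S zs * S xs
      term-o = begin
        (weight o o * ∏ zs (weight o)) * (weight o o * ∏ xs (weight o))
          ≈⟨ *-cong (*-cong w≈1 (weights-o zs (λ z∈ → z∈))) (*-cong w≈1 (weights-o xs sub)) ⟩
        (1# * (v ^ length zs * S zs)) * (1# * (v ^ length xs * S xs))
          ≈⟨ solve 4 (λ a b c d → (:1 :* (a :* b)) :* (:1 :* (c :* d)) := (a :* c) :* (b :* d)) refl _ _ _ _ ⟩
        (v ^ length zs * v ^ length xs) * (S zs * S xs)
          ≈⟨ *-congʳ (trans (sym (^-homo-* v (length zs) (length xs))) (trans (reflexive (≡.cong (v ^_) len)) (^-suc-q (⁻-≉0 _)))) ⟩
        (v * v) * (S zs * S xs)
          ≈⟨ *-congʳ (trans (*-cong v≈ v≈) (ε² o)) ⟩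
        1# * (S zs * S xs)
          ≈⟨ *-identityˡ _ ⟩
        S zs * S xs ∎
        where
        v = ε o ⁻
        v≈ : v ≈ ε o
        v≈ = ⁻-unique (ε² o)
        w≈1 : weight o o ≈ 1#
        w≈1 = ⁻-zero (trans (*-congˡ ⟨o,o⟩) (zeroʳ _))

      -- The two diagonal corrections give the square of `scale * s a`. The q + 1 factors `scale ⁻`
      -- amount to `scale ⁻` squared and cancel the square of `scale`; the two factors at infinity,
      -- with inverse `ε a * - s a`, cancel the square of `s a`, and squaring hides the signs.
      term-finite : ∀ {a} → a ∈ xs → term a ≈ (S zs * S xs) * (R zs a * R xs a)
      term-finite {a} a∈ = begin
        (u * ∏ zs (weight a)) * (u * ∏ xs (weight a))
          ≈⟨ *-cong (*-congˡ (weights-finite (sub a∈) uz (sub a∈) (λ z∈ → z∈))) (*-congˡ (weights-finite (sub a∈) ux a∈ sub)) ⟩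
        (u * ((k * s a) * (v ^ length zs * (S zs * R zs a)))) * (u * ((k * s a) * (v ^ length xs * (S xs * R xs a))))
          ≈⟨ solve 9 (λ u k s p q a b c d → (u :* ((k :* s) :* (p :* (a :* b)))) :* (u :* ((k :* s) :* (q :* (c :* d))))
               := ((p :* q) :* (k :* k)) :* ((u :* u) :* (s :* s)) :* ((a :* c) :* (b :* d))) refl _ _ _ _ _ _ _ _ _ ⟩
        ((v ^ length zs * v ^ length xs) * (k * k)) * ((u * u) * (s a * s a)) * (K * (R zs a * R xs a))
          ≈⟨ *-congʳ (*-cong (*-congʳ (trans (sym (^-homo-* v (length zs) (length xs))) (trans (reflexive (≡.cong (v ^_) len)) (^-suc-q (⁻-≉0 _))))) (*-congˡ ss)) ⟩
        ((v * v) * (k * k)) * ((u * u) * (w * w)) * (K * (R zs a * R xs a))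
          ≈⟨ *-congʳ (solve 4 (λ v k u w → ((v :* v) :* (k :* k)) :* ((u :* u) :* (w :* w)) := ((k :* v) :* (k :* v)) :* ((w :* u) :* (w :* u))) refl _ _ _ _) ⟩
        ((k * v) * (k * v)) * ((w * u) * (w * u)) * (K * (R zs a * R xs a))
          ≈⟨ *-congʳ (*-cong (*-cong kv kv) (*-cong wu wu)) ⟩
        (1# * 1#) * (1# * 1#) * (K * (R zs a * R xs a))
          ≈⟨ solve 1 (λ x → (:1 :* :1) :* (:1 :* :1) :* x := x) refl _ ⟩
        K * (R zs a * R xs a) ∎
        where
        K = S zs * S xs
        k = scale (sub a∈)
        v = k ⁻
        u = weight a o
        w = ε a * - s a
        kv : k * v ≈ 1#
        kv = *-inverseʳ (scale≉0 (sub a∈))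
        w≉0 : w ≉0
        w≉0 = ≉0-* (ε≉0 a) λ e → s≉0 (sub a∈) (trans (solve 1 (λ x → x := :- (:- x)) refl _) (trans (-‿cong e) (solve 0 (:- :0 := :0) refl)))
        wu : w * u ≈ 1#
        wu = trans (*-congˡ (⁻-cong (*-congˡ (⟨o,z⟩ (sub a∈))))) (*-inverseʳ w≉0)
        ss : s a * s a ≈ w * w
        ss = begin
          s a * s a                     ≈⟨ sym (*-identityˡ _) ⟩
          1# * (s a * s a)              ≈⟨ *-congʳ (sym (ε² a)) ⟩
          (ε a * ε a) * (s a * s a)     ≈⟨ solve 2 (λ e s → (e :* e) :* (s :* s) := (e :* (:- s)) :* (e :* (:- s))) refl _ _ ⟩
          w * w                         ∎

    -- Every term carries the same factor `S zs * S xs`. The term at infinity is this factor alone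
    -- and supplies the `1#` in `affine-identity`.
    ∑-projective : ∑ (o ∷ xs) (λ a → ∏ (o ∷ zs) (λ z → (ε a * ⟨ z , a ⟩) ⁻) *
                                     ∏ (o ∷ xs) (λ z → (ε a * ⟨ z , a ⟩) ⁻)) ≈ 0#
    ∑-projective = begin
      term o + ∑ xs term                                   ≈⟨ +-cong term-o (∑-cong xs term-finite) ⟩
      K + ∑ xs (λ a → K * (R zs a * R xs a))               ≈⟨ +-congˡ (∑-*ˡ xs K _) ⟩
      K + K * ∑ xs (λ a → R zs a * R xs a)                 ≈⟨ solve 2 (λ k s → k :+ k :* s := k :* (:1 :+ s)) refl _ _ ⟩
      K * (1# + ∑ xs (λ a → R zs a * R xs a))              ≈⟨ *-congˡ (+-congˡ reindexed) ⟩
      K * (1# + ∑ (map j xs) (λ a → R′ (map j zs) a * R′ (map j xs) a))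
        ≈⟨ *-congˡ (affine-identity (unique-map j j-inj uz) (unique-map j (λ x∈ y∈ → j-inj (sub x∈) (sub y∈)) ux) j-sub j-len) ⟩
      K * 0#                                               ≈⟨ zeroʳ K ⟩
      0#                                                   ∎
      where
      K = S zs * S xs
      j : I → Fin q
      j z = index (t z)
      R′ : List (Fin q) → Fin q → Carrier
      R′ ys a = ∏ ys (λ z → (enum a - enum z) ⁻)
      j-inj : ∀ {x y} → x ∈ zs → y ∈ zs → j x ≡ j y → x ≡ y
      j-inj x∈ y∈ e = t-inj x∈ y∈ (index-injective e)
      j-sub : ∀ {a} → a ∈ map j xs → a ∈ map j zs
      j-sub a∈ with ∈-map⁻ j a∈
      ... | _ , x∈ , ≡.refl = ∈-map⁺ j (sub x∈)
      j-len : length (map j zs) ℕ.+ length (map j xs) ≡ suc q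
      j-len = ≡.trans (≡.cong₂ ℕ._+_ (List.length-map j zs) (List.length-map j xs)) len
      R-index : ∀ ys a → R ys a ≈ R′ (map j ys) (j a)
      R-index ys a = sym (trans (reflexive (∏-map j ys _))
        (∏-cong ys (λ _ → ⁻-cong (+-cong (enum-index _) (-‿cong (enum-index _))))))
      reindexed : ∑ xs (λ a → R zs a * R xs a) ≈ ∑ (map j xs) (λ a → R′ (map j zs) a * R′ (map j xs) a)
      reindexed = trans (∑-cong xs (λ {a} _ → *-cong (R-index zs a) (R-index xs a)))
                        (reflexive (≡.sym (∑-map j xs _)))

  -- Determinants

  Σ-cong : ∀ n {f g : Fin n → Carrier} → (∀ i → f i ≈ g i) → Σ[ n ] f ≈ Σ[ n ] g
  Σ-cong zero    e = refl
  Σ-cong (suc n) e = +-cong (e zero) (Σ-cong n (e ∘ suc))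

  Σ-+ : ∀ n (f g : Fin n → Carrier) → Σ[ n ] (λ i → f i + g i) ≈ Σ[ n ] f + Σ[ n ] g
  Σ-+ zero    f g = sym (+-identityˡ _)
  Σ-+ (suc n) f g = trans (+-congˡ (Σ-+ n (f ∘ suc) (g ∘ suc)))
    (solve 4 (λ a b s t → (a :+ b) :+ (s :+ t) := (a :+ s) :+ (b :+ t)) refl _ _ _ _)

  Σ-*ˡ : ∀ n c (f : Fin n → Carrier) → Σ[ n ] (λ i → c * f i) ≈ c * Σ[ n ] f
  Σ-*ˡ zero    c f = sym (zeroʳ c)
  Σ-*ˡ (suc n) c f = trans (+-congˡ (Σ-*ˡ n c (f ∘ suc))) (sym (distribˡ _ _ _))

  Σ-zero : ∀ n {f : Fin n → Carrier} → (∀ i → f i ≈ 0#) → Σ[ n ] f ≈ 0#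
  Σ-zero zero    e = refl
  Σ-zero (suc n) e = trans (+-cong (e zero) (Σ-zero n (e ∘ suc))) (+-identityˡ _)

  Σ-single : ∀ n {f : Fin n → Carrier} j → (∀ i → i ≢ j → f i ≈ 0#) → Σ[ n ] f ≈ f j
  Σ-single (suc n) zero    e = trans (+-congˡ (Σ-zero n (λ i → e (suc i) λ ()))) (+-identityʳ _)
  Σ-single (suc n) (suc j) e = trans
    (+-cong (e zero λ ()) (Σ-single n j (λ i i≢ → e (suc i) (i≢ ∘ Fin.suc-injective)))) (+-identityˡ _)

  -- An opaque copy of Σ[_], so that summands can be inferred by unification.
  abstract
    Sum : ∀ n → (Fin n → Carrier) → Carrier
    Sum = Σ[_]

    Sum-suc : ∀ n (f : Fin (suc n) → Carrier) → Sum (suc n) f ≈ f zero + Sum n (f ∘ suc)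
    Sum-suc n f = refl

    Sum-empty : ∀ f → Sum zero f ≈ 0#
    Sum-empty f = refl

    det-expand : ∀ n M → det (suc n) M ≈
      Sum (suc n) (λ j → (alt (toℕ j) * M zero j) * det n (λ i l → M (suc i) (punchIn j l)))
    det-expand n M = refl

    Sum-cong : ∀ n {f g : Fin n → Carrier} → (∀ i → f i ≈ g i) → Sum n f ≈ Sum n g
    Sum-cong = Σ-cong

    Sum-+ : ∀ n (f g : Fin n → Carrier) → Sum n (λ i → f i + g i) ≈ Sum n f + Sum n g
    Sum-+ = Σ-+

    Sum-*ˡ : ∀ n c (f : Fin n → Carrier) → Sum n (λ i → c * f i) ≈ c * Sum n f
    Sum-*ˡ = Σ-*ˡ

    Sum-zero : ∀ n {f : Fin n → Carrier} → (∀ i → f i ≈ 0#) → Sum n f ≈ 0#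
    Sum-zero = Σ-zero

    Sum-single : ∀ n {f : Fin n → Carrier} j → (∀ i → i ≢ j → f i ≈ 0#) → Sum n f ≈ f j
    Sum-single = Σ-single

  infixl 6 _⊕_
  infixl 7 _⊙_

  _⊕_ : ∀ {k} → Vec k → Vec k → Vec k
  (u ⊕ v) i = u i + v i

  _⊙_ : ∀ {k} → Carrier → Vec k → Vec k
  (a ⊙ v) i = a * v i

  minor : ∀ {n} → Fin (suc n) → Vec (suc n) → Vec n
  minor j r l = r (punchIn j l)

  -- The determinant as a function of a list of rows, so that permuting rows is permuting a list.
  -- Missing rows count as zero rows, as in `nthD`, and excess rows are ignored.
  D : ∀ n → List (Vec n) → Carrier
  D zero    _        = 1#
  D (suc n) []       = 0#
  D (suc n) (r ∷ rs) = Sum (suc n) (λ j → (alt (toℕ j) * r j) * D n (map (minor j) rs))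

  D-cong : ∀ n {rs rs′} → Pointwise _≈V_ rs rs′ → D n rs ≈ D n rs′
  D-cong zero    _        = refl
  D-cong (suc n) []       = refl
  D-cong (suc n) (e ∷ es) = Sum-cong (suc n) (λ j →
    *-cong (*-congˡ (e j)) (D-cong n (Pointwise.map⁺ _ _ (Pointwise.map (λ e i → e (punchIn j i)) es))))

  det-cong : ∀ n {M M′ : Fin n → Fin n → Carrier} → (∀ i j → M i j ≈ M′ i j) → det n M ≈ det n M′
  det-cong zero    e = refl
  det-cong (suc n) {M} {M′} e = trans (det-expand n M) (trans (Sum-cong (suc n) (λ j →
    *-cong (*-congˡ (e zero j)) (det-cong n (λ i l → e (suc i) (punchIn j l))))) (sym (det-expand n M′)))

  det≈D-nthD : ∀ n rs → det n (λ i → nthD (λ _ → 0#) rs (toℕ i)) ≈ D n rs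
  det≈D-nthD zero    rs       = refl
  det≈D-nthD (suc n) []       = trans (det-expand n (λ i → nthD (λ _ → 0#) [] (toℕ i))) (Sum-zero (suc n) (λ j → trans (*-congʳ (zeroʳ _)) (zeroˡ _)))
  det≈D-nthD (suc n) (r ∷ rs) = trans (det-expand n (λ i → nthD (λ _ → 0#) (r ∷ rs) (toℕ i))) (Sum-cong (suc n) (λ j → *-congˡ (trans
    (det-cong n (λ i l → reflexive (nthD-minor j rs (toℕ i) l))) (det≈D-nthD n (map (minor j) rs)))))
    where
    nthD-minor : ∀ j rs x l → nthD (λ _ → 0#) rs x (punchIn j l) ≡ nthD (λ _ → 0#) (map (minor j) rs) x l
    nthD-minor j []       x       l = ≡.refl
    nthD-minor j (r ∷ rs) zero    l = ≡.refl
    nthD-minor j (r ∷ rs) (suc x) l = nthD-minor j rs x l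

  det-stackRows : ∀ n u rs → det (suc n) (stackRows u rs) ≈ D (suc n) (u ∷ rs)
  det-stackRows n u rs = trans
    (det-cong (suc n) {stackRows u rs} {λ i → nthD (λ _ → 0#) (u ∷ rs) (toℕ i)} (λ { zero _ → refl ; (suc i) _ → refl }))
    (det≈D-nthD (suc n) (u ∷ rs))

  det≈D : ∀ n (M : Fin n → Vec n) → det n M ≈ D n (tabulate M)
  det≈D n M = trans (det-cong n (λ i j → reflexive (≡.cong (λ r → r j) (nth-tabulate M i)))) (det≈D-nthD n (tabulate M))
    where
    nth-tabulate : ∀ {m} (M : Fin m → Vec n) i → M i ≡ nthD (λ _ → 0#) (tabulate M) (toℕ i)
    nth-tabulate M zero    = ≡.refl
    nth-tabulate M (suc i) = nth-tabulate (M ∘ suc) i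

  record Linear {k} (φ : Vec k → Carrier) : Set (c ⊔ ℓ) where
    field
      φ-cong : ∀ {u v} → u ≈V v → φ u ≈ φ v
      φ-⊕    : ∀ u v → φ (u ⊕ v) ≈ φ u + φ v
      φ-⊙    : ∀ a v → φ (a ⊙ v) ≈ a * φ v

    φ-0 : φ (λ _ → 0#) ≈ 0#
    φ-0 = trans (φ-cong (λ _ → sym (zeroˡ 0#))) (trans (φ-⊙ 0# (λ _ → 0#)) (zeroˡ _))

    φ-lincomb : ∀ {j} a (b : Fin j → Vec k) → φ (lincomb a b) ≈ Σ[ j ] (λ l → a l * φ (b l))
    φ-lincomb {zero}  a b = φ-0
    φ-lincomb {suc j} a b = trans (φ-⊕ _ _) (+-cong (φ-⊙ _ _) (φ-lincomb (a ∘ suc) (b ∘ suc)))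

    vanish-lincomb : ∀ {j} a (b : Fin j → Vec k) → (∀ l → φ (b l) ≈ 0#) → φ (lincomb a b) ≈ 0#
    vanish-lincomb a b e = trans (φ-lincomb a b) (Σ-zero _ (λ l → trans (*-congˡ (e l)) (zeroʳ _)))

    vanish : ∀ {j} {b : Fin j → Vec k} → Spanning b → (∀ l → φ (b l) ≈ 0#) → ∀ v → φ v ≈ 0#
    vanish {b = b} span e v = trans (φ-cong (λ i → sym (proj₂ (span v) i))) (vanish-lincomb (proj₁ (span v)) b e)

  D-linear : ∀ n rs → Linear (λ u → D (suc n) (u ∷ rs))
  D-linear n rs = record
    { φ-cong = λ e → D-cong (suc n) (e ∷ Pointwise.refl (λ _ → refl))
    ; φ-⊕ = λ u v → trans
        (Sum-cong (suc n) (λ j → solve 4 (λ a u v d → (a :* (u :+ v)) :* d := (a :* u) :* d :+ (a :* v) :* d) refl _ _ _ _))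
        (Sum-+ (suc n) _ _)
    ; φ-⊙ = λ a v → trans
        (Sum-cong (suc n) (λ j → solve 4 (λ a c v d → (a :* (c :* v)) :* d := c :* ((a :* v) :* d)) refl _ _ _ _))
        (Sum-*ˡ (suc n) a _)
    }

  module DLin n rs = Linear (D-linear n rs)

  lift : ∀ {m n} → (Fin m → Fin n) → Fin (suc m) → Fin (suc n)
  lift f zero    = zero
  lift f (suc x) = suc (f x)

  -- The terms (0 , l) and (suc l , 0) delete the same two columns with opposite signs.
  alternating-sum : ∀ n (u : Vec (suc (suc n))) (W : (Fin n → Fin (suc (suc n))) → Carrier) →
    (∀ {f g} → (∀ x → f x ≡ g x) → W f ≈ W g) →
    Sum (suc (suc n)) (λ j → (alt (toℕ j) * u j) *
      Sum (suc n) (λ l → (alt (toℕ l) * u (punchIn j l)) * W (λ x → punchIn j (punchIn l x)))) ≈ 0#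
  alternating-sum n u W W-cong = begin
    Sum (suc (suc n)) (λ j → (alt (toℕ j) * u j) * inner j)
      ≈⟨ Sum-suc (suc n) _ ⟩
    b * Sum (suc n) (λ l → (alt (toℕ l) * u (suc l)) * W′ l) + Sum (suc n) (λ j → a j * inner (suc j))
      ≈⟨ +-cong (sym (Sum-*ˡ (suc n) _ _)) (trans (Sum-cong (suc n) split) (Sum-+ (suc n) _ _)) ⟩
    Sum (suc n) (λ l → b * ((alt (toℕ l) * u (suc l)) * W′ l)) + (Sum (suc n) (λ j → a j * (b * W′ j)) + Sum (suc n) (λ j → a j * rest j))
      ≈⟨ trans (sym (+-assoc _ _ _)) (+-cong (sym (Sum-+ (suc n) _ _)) (remainder n u W W-cong)) ⟩
    Sum (suc n) (λ l → b * ((alt (toℕ l) * u (suc l)) * W′ l) + a l * (b * W′ l)) + 0#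
      ≈⟨ trans (+-identityʳ _) (Sum-zero (suc n) (λ l → solve 4 (λ x y w s → x :* ((s :* y) :* w) :+ ((:- s) :* y) :* (x :* w) := :0) refl b (u (suc l)) (W′ l) (alt (toℕ l)))) ⟩
    0# ∎
    where
    a : Fin (suc n) → Carrier
    a j = (- alt (toℕ j)) * u (suc j)
    b : Carrier
    b = 1# * u zero
    inner : Fin (suc (suc n)) → Carrier
    inner j = Sum (suc n) (λ l → (alt (toℕ l) * u (punchIn j l)) * W (λ x → punchIn j (punchIn l x)))
    W′ rest : Fin (suc n) → Carrier
    W′ l = W (λ x → suc (punchIn l x))
    rest j = Sum n (λ l → ((- alt (toℕ l)) * u (punchIn (suc j) (suc l))) * W (λ x → punchIn (suc j) (punchIn (suc l) x)))
    split : ∀ j → a j * inner (suc j) ≈ a j * (b * W′ j) + a j * rest j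
    split j = trans (*-congˡ (trans (Sum-suc n _) (+-congʳ (*-congˡ (W-cong λ _ → ≡.refl))))) (distribˡ _ _ _)
    -- The terms deleting two columns other than the first form the same double sum for the tail of
    -- `u`. Each of the two signs is shifted by one place, and the shifts cancel; `lift` keeps the
    -- first column in place.
    remainder : ∀ n (u : Vec (suc (suc n))) (W : (Fin n → Fin (suc (suc n))) → Carrier) →
      (∀ {f g} → (∀ x → f x ≡ g x) → W f ≈ W g) →
      Sum (suc n) (λ j → ((- alt (toℕ j)) * u (suc j)) *
        Sum n (λ l → ((- alt (toℕ l)) * u (punchIn (suc j) (suc l))) * W (λ x → punchIn (suc j) (punchIn (suc l) x)))) ≈ 0#
    remainder zero    u W W-cong = Sum-zero 1 (λ j → trans (*-congˡ (Sum-empty _)) (zeroʳ _))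
    remainder (suc n) u W W-cong = trans
      (Sum-cong (suc (suc n)) (λ j → trans (*-congˡ (trans
        (Sum-cong (suc n) (λ l → trans
          (*-congˡ (W-cong λ { zero → ≡.refl ; (suc x) → ≡.refl }))
          (solve 3 (λ s y w → ((:- s) :* y) :* w := (:- :1) :* ((s :* y) :* w)) refl _ _ _)))
        (Sum-*ˡ (suc n) (- 1#) _)))
        (solve 3 (λ s y w → ((:- s) :* y) :* ((:- :1) :* w) := (s :* y) :* w) refl _ _ _)))
      (alternating-sum n (u ∘ suc) (W ∘ lift) (λ e → W-cong λ { zero → ≡.refl ; (suc x) → ≡.cong suc (e x) }))

  -- After expanding along both copies of `u`, the remaining minor depends only on the columns kept:
  -- it is the `W` of `alternating-sum`.
  D-alternating : ∀ n u rs → D (suc (suc n)) (u ∷ u ∷ rs) ≈ 0#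
  D-alternating n u rs = trans
    (Sum-cong (suc (suc n)) (λ j → *-congˡ (Sum-cong (suc n) (λ l → *-congˡ (reflexive (≡.cong (D n) (≡.sym (List.map-∘ rs))))))))
    (alternating-sum n u (λ f → D n (map (λ r x → r (f x)) rs))
      (λ e → D-cong n (Pointwise.map⁺ _ _ (Pointwise.refl (λ {r} x → reflexive (≡.cong r (e x)))))))

  D-⊕₂ : ∀ n w u v rs → D (suc (suc n)) (w ∷ u ⊕ v ∷ rs) ≈ D (suc (suc n)) (w ∷ u ∷ rs) + D (suc (suc n)) (w ∷ v ∷ rs)
  D-⊕₂ n w u v rs = trans
    (Sum-cong (suc (suc n)) (λ j → trans (*-congˡ (DLin.φ-⊕ n (map (minor j) rs) (minor j u) (minor j v))) (distribˡ _ _ _)))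
    (Sum-+ (suc (suc n)) _ _)

  -- Polarisation: expand the vanishing determinant with `u ⊕ v` in both of the first two rows.
  D-swap : ∀ n u v rs → D (suc (suc n)) (u ∷ v ∷ rs) ≈ - D (suc (suc n)) (v ∷ u ∷ rs)
  D-swap n u v rs = begin
    uv                        ≈⟨ solve 2 (λ x y → x := ((:0 :+ x) :+ (y :+ :0)) :- y) refl uv vu ⟩
    ((0# + uv) + (vu + 0#)) - vu ≈⟨ +-congʳ (+-cong (trans (+-congʳ (sym (D-alternating n u rs))) (sym (D-⊕₂ n u u v rs)))
                                                 (trans (+-congˡ (sym (D-alternating n v rs))) (sym (D-⊕₂ n v u v rs)))) ⟩
    (D _ (u ∷ u ⊕ v ∷ rs) + D _ (v ∷ u ⊕ v ∷ rs)) - vu ≈⟨ +-congʳ (sym (DLin.φ-⊕ (suc n) (u ⊕ v ∷ rs) u v)) ⟩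
    D _ (u ⊕ v ∷ u ⊕ v ∷ rs) - vu  ≈⟨ +-congʳ (D-alternating n (u ⊕ v) rs) ⟩
    0# - vu                   ≈⟨ +-identityˡ _ ⟩
    - vu                      ∎
    where
    uv = D (suc (suc n)) (u ∷ v ∷ rs)
    vu = D (suc (suc n)) (v ∷ u ∷ rs)

  D-scaled : ∀ n ε r {rs rs′} → (∀ j → D n (map (minor j) rs) ≈ ε * D n (map (minor j) rs′)) →
             D (suc n) (r ∷ rs) ≈ ε * D (suc n) (r ∷ rs′)
  D-scaled n ε r e = trans
    (Sum-cong (suc n) (λ j → trans (*-congˡ (e j)) (solve 3 (λ a ε d → a :* (ε :* d) := ε :* (a :* d)) refl _ _ _)))
    (Sum-*ˡ (suc n) ε _)

  -- Swap the first two rows and expand, which reduces to minors with the same repetition. The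
  -- length is fixed because `D` ignores excess rows, where the second copy could hide.
  D-repeated : ∀ n {u rs} → length rs ≡ n → u ∈ rs → D (suc n) (u ∷ rs) ≈ 0#
  D-repeated (suc n) {u} {_ ∷ rs} len (here ≡.refl) = D-alternating n u rs
  D-repeated (suc n) {u} {r ∷ rs} len (there u∈) = begin
    D (suc (suc n)) (u ∷ r ∷ rs)         ≈⟨ D-swap n u r rs ⟩
    - D (suc (suc n)) (r ∷ u ∷ rs)       ≈⟨ -‿cong (Sum-zero (suc (suc n)) (λ j → trans (*-congˡ (D-repeated n
                                              (≡.trans (List.length-map (minor j) rs) (ℕ.suc-injective len)) (∈-map⁺ (minor j) u∈))) (zeroʳ _))) ⟩
    - 0#                                 ≈⟨ solve 0 (:- :0 := :0) refl ⟩
    0#                                   ∎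

  module _ {a} {A : Set a} where

    D-minor-map : ∀ n (f : A → Vec (suc n)) j xs → D n (map (minor j) (map f xs)) ≈ D n (map (minor j ∘ f) xs)
    D-minor-map n f j xs = reflexive (≡.cong (D n) (≡.sym (List.map-∘ xs)))

    -- One sign for all dimensions and all families of rows: uniformity in `f` lets the induction
    -- pass to minors, and later gives a sign independent of the vector put in the first row.
    RowSign : List A → List A → Carrier → Set (a ⊔ c ⊔ ℓ)
    RowSign xs ys ε = ∀ n (f : A → Vec n) → length xs ≡ n → D n (map f xs) ≈ ε * D n (map f ys)

    RowSign-cons : ∀ {xs ys ε} → RowSign xs ys ε →
      ∀ n (f : A → Vec (suc n)) u → length xs ≡ n → D (suc n) (u ∷ map f xs) ≈ ε * D (suc n) (u ∷ map f ys)
    RowSign-cons {xs} {ys} {ε} s n f u len = D-scaled n ε u (λ j →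
      trans (D-minor-map n f j xs) (trans (s n (minor j ∘ f) len) (*-congˡ (sym (D-minor-map n f j ys)))))

    RowSign-prep : ∀ {x xs ys ε} → RowSign xs ys ε → RowSign (x ∷ xs) (x ∷ ys) ε
    RowSign-prep {x} s (suc n) f len = RowSign-cons s n f (f x) (ℕ.suc-injective len)

    ↭⇒RowSign : ∀ {xs ys : List A} → xs ↭ ys → Σ Carrier λ ε → (ε * ε ≈ 1#) × RowSign xs ys ε
    ↭⇒RowSign Perm.refl = 1# , *-identityˡ 1# , λ n f len → sym (*-identityˡ _)
    ↭⇒RowSign (prep x p) with ↭⇒RowSign p
    ... | ε , ε² , s = ε , ε² , RowSign-prep s
    ↭⇒RowSign (swap x y p) with ↭⇒RowSign p
    ... | ε , ε² , s = - ε , trans (solve 1 (λ e → (:- e) :* (:- e) := e :* e) refl ε) ε² , λ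
      { (suc (suc n)) f len → trans (RowSign-prep (RowSign-prep s) (suc (suc n)) f len)
          (trans (*-congˡ (D-swap n (f x) (f y) _)) (solve 2 (λ e d → e :* (:- d) := (:- e) :* d) refl _ _)) }
    ↭⇒RowSign (Perm.trans p r) with ↭⇒RowSign p | ↭⇒RowSign r
    ... | ε , ε² , s | δ , δ² , t = ε * δ
      , trans (solve 2 (λ e d → (e :* d) :* (e :* d) := (e :* e) :* (d :* d)) refl ε δ) (trans (*-cong ε² δ²) (*-identityˡ _))
      , λ n f len → trans (s n f len) (trans (*-congˡ (t n f (≡.trans (≡.sym (Perm.↭-length p)) len))) (sym (*-assoc _ _ _)))

  -- Bases

  lincomb-⊕ : ∀ {j k} (a a′ : Vec j) (b : Fin j → Vec k) → lincomb (a ⊕ a′) b ≈V (lincomb a b ⊕ lincomb a′ b)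
  lincomb-⊕ {j} a a′ b i = trans (Σ-cong j (λ l → distribʳ _ _ _)) (Σ-+ j _ _)

  lincomb-⊙ : ∀ {j k} x (a : Vec j) (b : Fin j → Vec k) → lincomb (x ⊙ a) b ≈V (x ⊙ lincomb a b)
  lincomb-⊙ {j} x a b i = trans (Σ-cong j (λ l → *-assoc _ _ _)) (Σ-*ˡ j x _)

  lincomb-injective : ∀ {j k} {b : Fin j → Vec k} → LinearlyIndependent b →
                      ∀ a a′ → lincomb a b ≈V lincomb a′ b → a ≈V a′
  lincomb-injective {b = b} indep a a′ e l = -≈0⇒≈ (trans (+-congˡ (solve 1 (λ x → :- x := (:- :1) :* x) refl _))
    (indep (a ⊕ (- 1#) ⊙ a′) (λ i → trans (lincomb-⊕ a ((- 1#) ⊙ a′) b i)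
      (trans (+-cong (e i) (lincomb-⊙ (- 1#) a′ b i)) (solve 1 (λ x → x :+ (:- :1) :* x := :0) refl _))) l))

  module _ {k} (b : Fin k → Vec k) (bb : IsBasis b) where

    coords-spec : ∀ v → lincomb (coords {b = b} bb v) b ≈V v
    coords-spec v = proj₂ (proj₁ bb v)

    coords-unique : ∀ a {v} → lincomb a b ≈V v → coords {b = b} bb v ≈V a
    coords-unique a {v} e = lincomb-injective (proj₂ bb) _ _ (λ i → trans (coords-spec v i) (sym (e i)))

    -- Spanning alone picks some coefficients for each vector; independence makes the choice unique
    -- and therefore linear.
    coords-linear : ∀ l → Linear (λ v → coords {b = b} bb v l)
    coords-linear l = record
      { φ-cong = λ {u} {v} e → coords-unique (coords {b = b} bb v) (λ i → trans (coords-spec v i) (sym (e i))) l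
      ; φ-⊕ = λ u v → coords-unique (coords {b = b} bb u ⊕ coords {b = b} bb v)
          (λ i → trans (lincomb-⊕ _ _ b i) (+-cong (coords-spec u i) (coords-spec v i))) l
      ; φ-⊙ = λ a v → coords-unique (a ⊙ coords {b = b} bb v)
          (λ i → trans (lincomb-⊙ _ _ b i) (*-congˡ (coords-spec v i))) l
      }

  δ : ∀ {k} → Fin k → Vec k
  δ j i with i Fin.≟ j
  ... | yes _ = 1#
  ... | no  _ = 0#

  δ-diag : ∀ {k} (j : Fin k) → δ j j ≈ 1#
  δ-diag j with j Fin.≟ j
  ... | yes _  = refl
  ... | no j≢j = ⊥-elim (j≢j ≡.refl)

  δ-off : ∀ {k} {i j : Fin k} → i ≢ j → δ j i ≈ 0#
  δ-off {i = i} {j} i≢j with i Fin.≟ j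
  ... | yes e = ⊥-elim (i≢j e)
  ... | no  _ = refl

  δ-spanning : ∀ {k} → Spanning (δ {k})
  δ-spanning {k} v = v , λ i → trans
    (Σ-single k i (λ l l≢i → trans (*-congˡ (δ-off (l≢i ∘ ≡.sym))) (zeroʳ _)))
    (trans (*-congˡ (δ-diag i)) (*-identityʳ _))

  alt≉0 : ∀ n → alt n ≉0
  alt≉0 n = unit≉0 (square n)
    where
    square : ∀ n → alt n * alt n ≈ 1#
    square zero    = *-identityˡ 1#
    square (suc n) = trans (solve 1 (λ e → (:- e) :* (:- e) := e :* e) refl _) (square n)

  -- The hyperplane spanned by the rows of M other than the first is the kernel of φ = coords _ zero;
  -- deleting a column j with φ (δ j) ≉ 0 maps it isomorphically onto the whole space.
  minor-basis : ∀ {n} (M : Fin (suc n) → Vec (suc n)) (bM : IsBasis M) j →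
                coords {b = M} bM (δ j) zero ≉0 → IsBasis (λ i → minor j (M (suc i)))
  minor-basis {n} M bM j φδ≉0 = span , indep
    where
    φ : Vec (suc n) → Carrier
    φ v = coords {b = M} bM v zero
    open Linear (coords-linear M bM zero)

    φ-tail : ∀ b → φ (lincomb b (M ∘ suc)) ≈ 0#
    φ-tail b = coords-unique M bM tail (λ i → trans (+-congʳ (zeroˡ _)) (+-identityˡ _)) zero
      where
      tail : Vec (suc n)
      tail zero    = 0#
      tail (suc i) = b i

    span : Spanning (λ i → minor j (M (suc i)))
    span w = coords {b = M} bM v ∘ suc , λ l → begin
      lincomb (coords {b = M} bM v ∘ suc) (M ∘ suc) (punchIn j l)                                        ≈⟨ sym (+-identityˡ _) ⟩
      0# + lincomb (coords {b = M} bM v ∘ suc) (M ∘ suc) (punchIn j l)                                   ≈⟨ +-congʳ (sym (trans (*-congʳ φv) (zeroˡ _))) ⟩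
      φ v * M zero (punchIn j l) + lincomb (coords {b = M} bM v ∘ suc) (M ∘ suc) (punchIn j l)           ≈⟨ coords-spec M bM v (punchIn j l) ⟩
      insertAt w j 0# (punchIn j l) + s * δ j (punchIn j l)                                      ≈⟨ +-cong (reflexive (Vector.insertAt-punchIn w j 0# l)) (trans (*-congˡ (δ-off (Fin.punchInᵢ≢i j l))) (zeroʳ _)) ⟩
      w l + 0#                                                                                   ≈⟨ +-identityʳ _ ⟩
      w l                                                                                        ∎
      where
      -- Adding a multiple of `δ j` moves the lift of `w` into the kernel of `φ` and is invisible
      -- once column `j` is deleted.
      v₀ = insertAt w j 0#
      s = - (φ v₀ * φ (δ j) ⁻)
      v : Vec (suc n)
      v = v₀ ⊕ s ⊙ δ j
      φv : φ v ≈ 0#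
      φv = begin
        φ v                                                  ≈⟨ trans (φ-⊕ v₀ (s ⊙ δ j)) (+-congˡ (φ-⊙ s (δ j))) ⟩
        φ v₀ + - (φ v₀ * φ (δ j) ⁻) * φ (δ j)                ≈⟨ solve 3 (λ a i d → a :+ (:- (a :* i)) :* d := a :* (:1 :- (d :* i))) refl _ _ _ ⟩
        φ v₀ * (1# - φ (δ j) * φ (δ j) ⁻)                    ≈⟨ *-congˡ (+-congˡ (-‿cong (*-inverseʳ φδ≉0))) ⟩
        φ v₀ * (1# - 1#)                                     ≈⟨ trans (*-congˡ (-‿inverseʳ 1#)) (zeroʳ _) ⟩
        0#                                                   ∎

    indep : LinearlyIndependent (λ i → minor j (M (suc i)))
    indep b e l = proj₂ bM padded (λ i → trans (+-congʳ (zeroˡ _)) (trans (+-identityˡ _) (u≈0 i))) (suc l)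
      where
      padded : Vec (suc n)
      padded zero    = 0#
      padded (suc i) = b i
      u = lincomb b (M ∘ suc)
      -- With all entries outside column `j` zero, `u` is a multiple of `δ j`; it also lies in the
      -- kernel of `φ`, which does not contain `δ j`.
      u≈uj : u ≈V (u j ⊙ δ j)
      u≈uj i with i Fin.≟ j
      ... | yes ≡.refl = sym (*-identityʳ _)
      ... | no  i≢j = trans
        (≡.subst (λ i → u i ≈ 0#) (Fin.punchIn-punchOut (i≢j ∘ ≡.sym)) (e _)) (sym (zeroʳ _))
      uj≈0 : u j ≈ 0#
      uj≈0 = *-cancelˡ φδ≉0 (trans (*-comm _ _) (trans (sym (φ-⊙ (u j) (δ j)))
        (trans (φ-cong (λ i → sym (u≈uj i))) (trans (φ-tail b) (sym (zeroʳ _))))))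
      u≈0 : ∀ i → u i ≈ 0#
      u≈0 i = trans (u≈uj i) (trans (*-congʳ uj≈0) (zeroˡ _))

  -- If det M vanished, so would the functional det (u , M₁ , … , Mₙ) of u, and hence every maximal minor of M₁ , … , Mₙ.
  det-basis : ∀ n (M : Fin n → Vec n) → IsBasis M → det n M ≉0
  det-basis zero    _ _ = 1≉0
  det-basis (suc n) M bM det≈0 = 1≉0 (trans (sym φM₀) (Linear.vanish (coords-linear M bM zero) {b = δ} δ-spanning φδ≈0 (M zero)))
    where
    rows = tabulate (M ∘ suc)
    
    on-rows : ∀ i → D (suc n) (M i ∷ rows) ≈ 0#
    on-rows zero    = trans (sym (det≈D (suc n) M)) det≈0
    on-rows (suc i) = D-repeated n (List.length-tabulate _) (∈-tabulate⁺ i)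

    cofactor≈0 : ∀ j → D n (map (minor j) rows) ≈ 0#
    cofactor≈0 j = *-cancelˡ (alt≉0 (toℕ j)) (begin
      alt (toℕ j) * D n (map (minor j) rows)              ≈⟨ *-congʳ (sym (trans (*-congˡ (δ-diag j)) (*-identityʳ _))) ⟩
      (alt (toℕ j) * δ j j) * D n (map (minor j) rows)
        ≈⟨ sym (Sum-single (suc n) j (λ l l≢j → trans (*-congʳ (trans (*-congˡ (δ-off l≢j)) (zeroʳ (alt (toℕ l))))) (zeroˡ (D n (map (minor l) rows))))) ⟩
      D (suc n) (δ j ∷ rows)                              ≈⟨ DLin.vanish n rows {b = M} (proj₁ bM) on-rows (δ j) ⟩
      0#                                                  ≈⟨ sym (zeroʳ _) ⟩
      alt (toℕ j) * 0#                                    ∎)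

    -- A nonzero value would make the rows of this minor a basis, and its determinant nonzero by
    -- induction. Hence `φ` vanishes on the standard basis, although it is `1#` at `M zero`.
    φδ≈0 : ∀ j → coords {b = M} bM (δ j) zero ≈ 0#
    φδ≈0 j with coords {b = M} bM (δ j) zero ≟ 0#
    ... | yes e   = e
    ... | no  nz = ⊥-elim (det-basis n (λ i → minor j (M (suc i))) (minor-basis M bM j nz) (trans (det≈D n (λ i → minor j (M (suc i))))
                     (trans (reflexive (≡.cong (D n) (≡.sym (List.map-tabulate (M ∘ suc) (minor j))))) (cofactor≈0 j))))

    φM₀ : coords {b = M} bM (M zero) zero ≈ 1#
    φM₀ = trans (coords-unique M bM (δ zero) (λ i → trans
      (Σ-single (suc n) {λ l → δ zero l * M l i} zero (λ l l≢0 → trans (*-congʳ (δ-off l≢0)) (zeroˡ (M l i))))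
      (trans (*-congʳ (δ-diag {suc n} zero)) (*-identityˡ _))) zero) (δ-diag {suc n} zero)

  coords-basis : ∀ {k} (B : Fin k → Vec k) (bB : IsBasis B) (b : Fin k → Vec k) → IsBasis b →
                 IsBasis (λ i → coords {b = B} bB (b i))
  coords-basis {k} B bB b bb@(span , indep) = span′ , indep′
    where
    coords-lincomb : ∀ a → coords {b = B} bB (lincomb a b) ≈V lincomb a (λ i → coords {b = B} bB (b i))
    coords-lincomb a l = Linear.φ-lincomb (coords-linear B bB l) a b

    span′ : Spanning (λ i → coords {b = B} bB (b i))
    span′ w = a , λ l → trans (sym (coords-lincomb a l))
      (coords-unique B bB w (λ i → sym (coords-spec b bb v i)) l)
      where
      v = lincomb w B
      a = coords {b = b} bb v

    indep′ : LinearlyIndependent (λ i → coords {b = B} bB (b i))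
    indep′ a e = indep a λ i → trans (sym (coords-spec B bB (lincomb a b) i))
      (Σ-zero k (λ l → trans (*-congʳ (trans (coords-lincomb a l) (e l))) (zeroˡ _)))

  -- Determinants on arcs.

  AllBases : ∀ {N k} → (Fin N → Vec k) → Set (c ⊔ ℓ)
  AllBases {N} {k} h = ∀ (σ : Fin k → Fin N) → StrictlyIncreasing σ → IsBasis (λ i → h (σ i))

  D-increasing : ∀ {N k} (h : Fin N → Vec k) → AllBases h →
                 ∀ xs → AllPairs _<_ xs → length xs ≡ k → D k (map h xs) ≉0
  D-increasing h arc xs inc ≡.refl D≈0 = det-basis (length xs) (h ∘ lookup xs)
    (arc (lookup xs) (allPairs-lookup inc))
    (trans (det≈D (length xs) (h ∘ lookup xs)) (trans (reflexive (≡.cong (D (length xs))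
      (≡.trans (≡.sym (List.map-tabulate (lookup xs) h)) (≡.cong (map h) (List.tabulate-lookup xs))))) D≈0))

  vanish-increasing : ∀ {N k} (h : Fin N → Vec k) → AllBases h →
    ∀ xs → AllPairs _<_ xs → length xs ≡ k →
    ∀ {φ} → Linear φ → (∀ {x} → x ∈ xs → φ (h x) ≈ 0#) → ∀ v → φ v ≈ 0#
  vanish-increasing h arc xs inc ≡.refl lin e = Linear.vanish lin {b = h ∘ lookup xs}
    (proj₁ (arc (lookup xs) (allPairs-lookup inc))) (λ i → e (∈-lookup i))

  module Arc {N k} (h : Fin N → Vec k) (arc : AllBases h) where

    D-unique : ∀ {xs} → Unique xs → length xs ≡ k → D k (map h xs) ≉0
    D-unique {xs} ux len D≈0 with ↭⇒RowSign (↭-sorted ux)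
    ... | ε , ε² , s = ≉0-* (unit≉0 ε²)
      (D-increasing h arc (sorted xs) (sorted-increasing xs) (≡.trans (≡.sym (Perm.↭-length (↭-sorted ux))) len))
      (trans (sym (s k h len)) D≈0)

    vanish-unique : ∀ {xs} → Unique xs → length xs ≡ k →
      ∀ {φ} → Linear φ → (∀ {x} → x ∈ xs → φ (h x) ≈ 0#) → ∀ v → φ v ≈ 0#
    vanish-unique {xs} ux len lin e = vanish-increasing h arc (sorted xs) (sorted-increasing xs)
      (≡.trans (≡.sym (Perm.↭-length (↭-sorted ux))) len) lin
      (λ x∈ → e (Perm.∈-resp-↭ (↭-sym (↭-sorted ux)) x∈))

  -- The plane obtained by factoring out the span of a subfamily of codimension two.

  module Pencil {N k} (h : Fin N → Vec (suc (suc k))) (arc : AllBases h)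
                (as : List (Fin N)) (ua : Unique as) (len-as : length as ≡ k) where
    open Arc h arc

    rows : List (Vec (suc (suc k)))
    rows = map h as

    -- The alternating form induced on the quotient plane modulo the span of `as`.
    bracket : Vec (suc (suc k)) → Vec (suc (suc k)) → Carrier
    bracket u v = D (suc (suc k)) (u ∷ v ∷ rows)

    ⟨_,_⟩ : Fin N → Fin N → Carrier
    ⟨ z , a ⟩ = bracket (h z) (h a)

    ⟨⟩-antisym : ∀ z a → ⟨ z , a ⟩ ≈ - ⟨ a , z ⟩
    ⟨⟩-antisym z a = D-swap k (h z) (h a) rows

    ⟨⟩-diag : ∀ a → ⟨ a , a ⟩ ≈ 0#
    ⟨⟩-diag a = D-alternating k (h a) rows

    bracket-rows : ∀ {x} v → x ∈ as → bracket (h x) v ≈ 0#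
    bracket-rows v x∈ = D-repeated (suc k) {rs = v ∷ rows} (≡.cong suc (≡.trans (List.length-map h as) len-as)) (there (∈-map⁺ h x∈))

    unique-pair : ∀ {y z} → y ∉ as → z ∉ as → y ≢ z → Unique (y ∷ z ∷ as)
    unique-pair y∉ z∉ y≢z = unique-∷ (λ { (here e) → y≢z e ; (there y∈) → y∉ y∈ }) (unique-∷ z∉ ua)

    ⟨⟩-≉0 : ∀ {y z} → y ∉ as → z ∉ as → y ≢ z → ⟨ y , z ⟩ ≉0
    ⟨⟩-≉0 y∉ z∉ y≢z = D-unique (unique-pair y∉ z∉ y≢z) (≡.cong (λ r → suc (suc r)) len-as)

    -- The difference of both sides is a linear functional of h z that vanishes on the basis o , f , as.
    plücker : ∀ {o f} → o ∉ as → f ∉ as → o ≢ f → ∀ z a →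
              ⟨ z , a ⟩ * ⟨ o , f ⟩ ≈ ⟨ z , o ⟩ * ⟨ a , f ⟩ - ⟨ z , f ⟩ * ⟨ a , o ⟩
    plücker {o} {f} o∉ f∉ o≢f z a = -≈0⇒≈ (vanish-unique (unique-pair o∉ f∉ o≢f) (≡.cong (λ r → suc (suc r)) len-as) linear on-basis (h z))
      where
      φ : Vec (suc (suc k)) → Carrier
      φ v = bracket v (h a) * ⟨ o , f ⟩ - (bracket v (h o) * ⟨ a , f ⟩ - bracket v (h f) * ⟨ a , o ⟩)
      module L x = DLin (suc k) (h x ∷ rows)
      linear : Linear φ
      linear = record
        { φ-cong = λ e → +-cong (*-congʳ (L.φ-cong a e)) (-‿cong (+-cong (*-congʳ (L.φ-cong o e)) (-‿cong (*-congʳ (L.φ-cong f e)))))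
        ; φ-⊕ = λ u v → trans
            (+-cong (*-congʳ (L.φ-⊕ a u v)) (-‿cong (+-cong (*-congʳ (L.φ-⊕ o u v)) (-‿cong (*-congʳ (L.φ-⊕ f u v))))))
            (solve 9 (λ a a′ o o′ f f′ x y z → (a :+ a′) :* x :- ((o :+ o′) :* y :- (f :+ f′) :* z)
               := (a :* x :- (o :* y :- f :* z)) :+ (a′ :* x :- (o′ :* y :- f′ :* z))) refl _ _ _ _ _ _ _ _ _)
        ; φ-⊙ = λ s v → trans
            (+-cong (*-congʳ (L.φ-⊙ a s v)) (-‿cong (+-cong (*-congʳ (L.φ-⊙ o s v)) (-‿cong (*-congʳ (L.φ-⊙ f s v))))))
            (solve 7 (λ s a o f x y z → (s :* a) :* x :- ((s :* o) :* y :- (s :* f) :* z)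
               := s :* (a :* x :- (o :* y :- f :* z))) refl _ _ _ _ _ _ _)
        }
      on-basis : ∀ {x} → x ∈ o ∷ f ∷ as → φ (h x) ≈ 0#
      on-basis (here ≡.refl) = trans
        (+-cong (*-congʳ (⟨⟩-antisym o a)) (-‿cong (+-congʳ (*-congʳ (⟨⟩-diag o)))))
        (solve 3 (λ x y z → (:- x) :* y :- (:0 :* z :- y :* x) := :0) refl _ _ _)
      on-basis (there (here ≡.refl)) = trans
        (+-cong (*-congʳ (⟨⟩-antisym f a)) (-‿cong (+-cong (*-congʳ (⟨⟩-antisym f o)) (-‿cong (*-congʳ (⟨⟩-diag f))))))
        (solve 3 (λ x y z → (:- x) :* y :- ((:- y) :* x :- :0 :* z) := :0) refl _ _ _)
      on-basis (there (there x∈)) = trans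
        (+-cong (*-congʳ (bracket-rows (h a) x∈)) (-‿cong (+-cong (*-congʳ (bracket-rows (h o) x∈)) (-‿cong (*-congʳ (bracket-rows (h f) x∈))))))
        (solve 3 (λ x y z → :0 :* x :- (:0 :* y :- :0 :* z) := :0) refl _ _ _)

    module _ (o : Fin N) (o∉ : o ∉ as) where

      others : List (Fin N)
      others = complement (o ∷ as)

      -- The points `o` and `f` provide coordinates: `⟨ z , o ⟩` is the scale of `z` and `⟨ z , f ⟩`
      -- divided by it the affine parameter. By `plücker` the form becomes a difference of
      -- parameters up to scales and `⟨ o , f ⟩ ⁻`; parameters are distinct because brackets of
      -- distinct arc points outside `as` do not vanish.
      pencil-identity : ∀ {xs} (ε : Fin N → Carrier) → (∀ a → ε a * ε a ≈ 1#) →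
        Unique xs → (∀ {a} → a ∈ xs → a ∈ others) → length others ℕ.+ length xs ≡ suc q →
        ∀ {f} → f ∈ others →
        ∑ (o ∷ xs) (λ a → ∏ (o ∷ others) (λ z → (ε a * ⟨ z , a ⟩) ⁻) * ∏ (o ∷ xs) (λ z → (ε a * ⟨ z , a ⟩) ⁻)) ≈ 0#
      pencil-identity {xs} ε ε² ux sub len {f} f∈ = ProjectiveLine.∑-projective ⟨_,_⟩ ε o others xs
        (⟨ o , f ⟩ ⁻) s t (complement-unique (o ∷ as)) ux sub len (⁻-≉0 _) s≉0 t-inj ε² finite
        (λ _ → refl) (λ _ → ⟨⟩-antisym o _) (⟨⟩-diag o)
        where
        s t : Fin N → Carrier
        s z = ⟨ z , o ⟩
        t z = ⟨ z , f ⟩ * s z ⁻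
        ∉as : ∀ {z} → z ∈ others → z ∉ as
        ∉as z∈ z∈as = ∈-complement⁻ z∈ (there z∈as)
        ≢o : ∀ {z} → z ∈ others → z ≢ o
        ≢o z∈ e = ∈-complement⁻ z∈ (here e)
        s≉0 : ∀ {z} → z ∈ others → s z ≉0
        s≉0 z∈ = ⟨⟩-≉0 (∉as z∈) o∉ (≢o z∈)
        st : ∀ {z} → z ∈ others → s z * t z ≈ ⟨ z , f ⟩
        st z∈ = trans (solve 3 (λ s f i → s :* (f :* i) := f :* (s :* i)) refl _ _ _)
                      (trans (*-congˡ (*-inverseʳ (s≉0 z∈))) (*-identityʳ _))
        finite : ∀ {z a} → z ∈ others → a ∈ others → ⟨ z , a ⟩ ≈ ⟨ o , f ⟩ ⁻ * (s z * (s a * (t a - t z)))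
        finite {z} {a} z∈ a∈ = begin
          ⟨ z , a ⟩                                                     ≈⟨ sym (*-identityʳ _) ⟩
          ⟨ z , a ⟩ * 1#                                                ≈⟨ *-congˡ (sym (*-inverseʳ (⟨⟩-≉0 o∉ (∉as f∈) (≢o f∈ ∘ ≡.sym)))) ⟩
          ⟨ z , a ⟩ * (⟨ o , f ⟩ * κ)                                   ≈⟨ solve 3 (λ x y i → x :* (y :* i) := i :* (x :* y)) refl _ _ _ ⟩
          κ * (⟨ z , a ⟩ * ⟨ o , f ⟩)                                   ≈⟨ *-congˡ (plücker o∉ (∉as f∈) (≢o f∈ ∘ ≡.sym) z a) ⟩
          κ * (s z * ⟨ a , f ⟩ - ⟨ z , f ⟩ * s a)                       ≈⟨ *-congˡ (+-cong (*-congˡ (sym (st a∈))) (-‿cong (*-congʳ (sym (st z∈))))) ⟩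
          κ * (s z * (s a * t a) - (s z * t z) * s a)                   ≈⟨ *-congˡ (solve 4 (λ x y u v → x :* (y :* u) :- (x :* v) :* y := x :* (y :* (u :- v))) refl _ _ _ _) ⟩
          κ * (s z * (s a * (t a - t z)))                               ∎
          where κ = ⟨ o , f ⟩ ⁻
        t-inj : ∀ {y z} → y ∈ others → z ∈ others → t y ≈ t z → y ≡ z
        t-inj {y} {z} y∈ z∈ e with y Fin.≟ z
        ... | yes y≡z = y≡z
        ... | no  y≢z = ⊥-elim (⟨⟩-≉0 (∉as y∈) (∉as z∈) y≢z (begin
          ⟨ y , z ⟩                                          ≈⟨ finite y∈ z∈ ⟩
          ⟨ o , f ⟩ ⁻ * (s y * (s z * (t z - t y)))          ≈⟨ *-congˡ (*-congˡ (*-congˡ (+-congˡ (-‿cong e)))) ⟩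
          ⟨ o , f ⟩ ⁻ * (s y * (s z * (t z - t z)))          ≈⟨ solve 4 (λ k a b t → k :* (a :* (b :* (t :- t))) := :0) refl _ _ _ _ ⟩
          0#                                                 ∎))

  -- Sums over all subsets.

  ∑-concatMap : ∀ {a} {A : Set a} (f : A → List Carrier) xs → sumL (concatMap f xs) ≈ ∑ xs (λ x → sumL (f x))
  ∑-concatMap f []       = refl
  ∑-concatMap f (x ∷ xs) = trans (sumL-++ (f x)) (+-congˡ (∑-concatMap f xs))
    where
    sumL-++ : ∀ ys {zs} → sumL (ys ++ zs) ≈ sumL ys + sumL zs
    sumL-++ []       = sym (+-identityˡ _)
    sumL-++ (y ∷ ys) = trans (+-congˡ (sumL-++ ys)) (sym (+-assoc _ _ _))

  ∑-allSubsets : ∀ m (g : Subset (suc m) → Carrier) →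
    ∑ (allSubsets (suc m)) g ≈ ∑ (allSubsets m) (g ∘ (true ∷_)) + ∑ (allSubsets m) (g ∘ (false ∷_))
  ∑-allSubsets m g = trans (∑-++ (map (true ∷_) (allSubsets m)) g)
    (+-cong (reflexive (∑-map (true ∷_) (allSubsets m) g)) (reflexive (∑-map (false ∷_) (allSubsets m) g)))

  ∑-allSubsets-single : ∀ {m} (P : Subset m) {g : Subset m → Carrier} →
    (∀ C → C ≢ P → g C ≈ 0#) → ∑ (allSubsets m) g ≈ g P
  ∑-allSubsets-single {zero}  []          e = +-identityʳ _
  ∑-allSubsets-single {suc m} (true ∷ P) {g} e = trans (∑-allSubsets m g) (trans
    (+-cong (∑-allSubsets-single P (λ C C≢P → e (true ∷ C) λ { ≡.refl → C≢P ≡.refl }))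
            (∑-zero (allSubsets m) (λ _ → e _ λ ()))) (+-identityʳ _))
  ∑-allSubsets-single {suc m} (false ∷ P) {g} e = trans (∑-allSubsets m g) (trans
    (+-cong (∑-zero (allSubsets m) (λ _ → e _ λ ()))
            (∑-allSubsets-single P (λ C C≢P → e (false ∷ C) λ { ≡.refl → C≢P ≡.refl }))) (+-identityˡ _))

  -- A column `(U , A)` meets only the rows that add one element to `A`; this turns its sum into one
  -- over the added element.
  ∑-covers : ∀ {m} (A : Subset m) {g : Subset m → Carrier} →
    (∀ C → ¬ (A ⊆ C × ∣ C ∣ ≡ suc ∣ A ∣) → g C ≈ 0#) →
    ∑ (allSubsets m) g ≈ ∑ (elems (∁ A)) (λ a → g (A [ a ]≔ true))
  ∑-covers {zero}  [] e = trans (+-identityʳ _) (e [] λ ())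
  ∑-covers {suc m} (true ∷ A) {g} e = begin
    ∑ (allSubsets (suc m)) g
      ≈⟨ ∑-allSubsets m g ⟩
    ∑ (allSubsets m) (g ∘ (true ∷_)) + ∑ (allSubsets m) (g ∘ (false ∷_))
      ≈⟨ +-cong (∑-covers A (λ C ¬p → e (true ∷ C) λ (sub , card) → ¬p (Subset.drop-∷-⊆ sub , ℕ.suc-injective card)))
                (∑-zero (allSubsets m) (λ {C} _ → e (false ∷ C) λ (sub , _) → zero∉ (sub here))) ⟩
    ∑ (elems (∁ A)) (λ a → g (true ∷ (A [ a ]≔ true))) + 0#
      ≈⟨ +-identityʳ _ ⟩
    ∑ (elems (∁ A)) (λ a → g (true ∷ (A [ a ]≔ true)))
      ≈⟨ reflexive (≡.sym (∑-map suc (elems (∁ A)) _)) ⟩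
    ∑ (map suc (elems (∁ A))) (λ a → g ((true ∷ A) [ a ]≔ true)) ∎
    where
    zero∉ : ∀ {C : Subset m} → ¬ (zero ∈ₛ (false ∷ C))
    zero∉ ()
  ∑-covers {suc m} (false ∷ A) {g} e = begin
    ∑ (allSubsets (suc m)) g
      ≈⟨ ∑-allSubsets m g ⟩
    ∑ (allSubsets m) (g ∘ (true ∷_)) + ∑ (allSubsets m) (g ∘ (false ∷_))
      ≈⟨ +-cong (∑-allSubsets-single A (λ C C≢A → e (true ∷ C) λ (sub , card) → C≢A (⊆∧∣∣≡⇒≡ (Subset.drop-∷-⊆ sub) (ℕ.suc-injective card))))
                (∑-covers A (λ C ¬p → e (false ∷ C) λ (sub , card) → ¬p (Subset.drop-∷-⊆ sub , card))) ⟩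
    g (true ∷ A) + ∑ (elems (∁ A)) (λ a → g (false ∷ (A [ a ]≔ true)))
      ≈⟨ +-congˡ (reflexive (≡.sym (∑-map suc (elems (∁ A)) _))) ⟩
    g (true ∷ A) + ∑ (map suc (elems (∁ A))) (λ a → g ((false ∷ A) [ a ]≔ true)) ∎

  -- The functional that annihilates every column.

  -- The parameter k is the paper's k minus two.
  module Orthogonality {k m N n : ℕ} (G : Fin m → Vec (suc (suc k))) (H : Fin N → Vec (suc (suc k)))
    (arc : AllBases H) (ι : Fin m → Fin N) (ι-inj : ∀ {i j} → ι i ≡ ι j → i ≡ j)
    (ι-eq : ∀ i → H (ι i) ≈V G i) (B : Fin (suc (suc k)) → Vec (suc (suc k))) (bB : IsBasis B)
    (large-N : suc (suc k) ℕ.≤ N) (large-m : suc (k ℕ.+ n) ℕ.≤ m)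
    (count : N ℕ.+ m ≡ suc q ℕ.+ (suc k ℕ.+ suc (k ℕ.+ n))) where

    open Matrix G {B} bB n

    h : Fin N → Vec (suc (suc k))
    h z = coords {b = B} bB (H z)

    arc-h : AllBases h
    arc-h σ inc = coords-basis B bB (H ∘ σ) (arc σ inc)

    h-ι : ∀ i → coords {b = B} bB (G i) ≈V h (ι i)
    h-ι i l = Linear.φ-cong (coords-linear B bB l) (λ j → sym (ι-eq i j))

    rowsOf : Subset m → List (Fin N)
    rowsOf C = map ι (elems C)

    rowsOf-unique : ∀ C → Unique (rowsOf C)
    rowsOf-unique C = Unique.map⁺ ι-inj (elems-unique C)

    length-rowsOf : ∀ C → length (rowsOf C) ≡ ∣ C ∣
    length-rowsOf C = ≡.trans (List.length-map ι (elems C)) (length-elems C)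

    Δ : Fin N → Subset m → Carrier
    Δ z C = D (suc (suc k)) (h z ∷ map h (rowsOf C))

    detB≈Δ : ∀ u C → detB (G u) C ≈ Δ (ι u) C
    detB≈Δ u C = trans (det-stackRows (suc k) (coords {b = B} bB (G u)) (map (λ g → coords {b = B} bB (G g)) (elems C))) (D-cong (suc (suc k)) (h-ι u ∷ rows≈ (elems C)))
      where
      rows≈ : ∀ l → Pointwise _≈V_ (map (λ g → coords {b = B} bB (G g)) l) (map h (map ι l))
      rows≈ []      = []
      rows≈ (x ∷ l) = h-ι x ∷ rows≈ l

    Δ-repeated : ∀ {z C} → ∣ C ∣ ≡ suc k → z ∈ rowsOf C → Δ z C ≈ 0#
    Δ-repeated {z} {C} card z∈ = D-repeated (suc k) {rs = map h (rowsOf C)}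
      (≡.trans (List.length-map h (rowsOf C)) (≡.trans (length-rowsOf C) card)) (∈-map⁺ h z∈)

    Δ-≉0 : ∀ {z C} → ∣ C ∣ ≡ suc k → z ∉ rowsOf C → Δ z C ≉0
    Δ-≉0 {z} {C} card z∉ = Arc.D-unique h arc-h (unique-∷ z∉ (rowsOf-unique C))
      (≡.cong suc (≡.trans (length-rowsOf C) card))

    -- Up to signs, T_A(a) = const_A / ∏_{z ∈ H \ (A ∪ a)} det(a , z , A) for the tangent function T_A,
    -- so the first product plays the role of the tangent functions and no lemma of tangents is needed.
    weights : Subset m → Carrier
    weights C = ∏ (allFin N) (λ z → Δ z C ⁻) * ∏ (allFin m) (λ u → Δ (ι u) C ⁻)

    weights-≉0 : ∀ C → weights C ≉0
    weights-≉0 C = ≉0-* (∏-≉0 (allFin N) (λ _ → ⁻-≉0 _)) (∏-≉0 (allFin m) (λ _ → ⁻-≉0 _))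

    -- Extended by zero beyond the row indices, so that the pairing can run over all subsets.
    functional : Subset m → Carrier
    functional C = if does (∣ C ∣ ℕ.≟ suc k) then weights C else 0#

    functional-row : ∀ {C} → ∣ C ∣ ≡ suc k → functional C ≡ weights C
    functional-row {C} card = ≡.cong (if_then weights C else 0#) (dec-true (∣ C ∣ ℕ.≟ suc k) card)

    functional-other : ∀ {C} → ¬ (∣ C ∣ ≡ suc k) → functional C ≡ 0#
    functional-other {C} card = ≡.cong (if_then weights C else 0#) (dec-false (∣ C ∣ ℕ.≟ suc k) card)

    Valid : (C U A : Subset m) → Set
    Valid C U A = ∣ U ∣ ≡ n × ∣ A ∣ ≡ k × A ⊆ ∁ U × A ⊆ C × C ⊆ ∁ U

    -- Nested like the boolean condition in `entry`, so that its `does` is that condition by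
    -- computation.
    valid? : ∀ C U A → Dec (Valid C U A)
    valid? C U A = (∣ U ∣ ℕ.≟ n) ×-dec (∣ A ∣ ℕ.≟ k) ×-dec (A Subset.⊆? ∁ U) ×-dec (A Subset.⊆? C) ×-dec (C Subset.⊆? ∁ U)

    entry-valid : ∀ {C U A} → Valid C U A → entry C U A ≡ ∏ (elems U) (λ u → detB (G u) C)
    entry-valid {C} {U} {A} v = ≡.cong (if_then ∏ (elems U) (λ u → detB (G u) C) else 0#) (dec-true (valid? C U A) v)

    entry-invalid : ∀ {C U A} → ¬ Valid C U A → entry C U A ≡ 0#
    entry-invalid {C} {U} {A} v = ≡.cong (if_then ∏ (elems U) (λ u → detB (G u) C) else 0#) (dec-false (valid? C U A) v)

    module Column (U A : Subset m) (card-U : ∣ U ∣ ≡ n) (card-A : ∣ A ∣ ≡ k) (A⊆∁U : A ⊆ ∁ U) where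

      as : List (Fin N)
      as = rowsOf A

      open Pencil h arc-h as (rowsOf-unique A) (≡.trans (length-rowsOf A) card-A)
      open DecMembership (Fin._≟_ {m}) using (_∈?_)

      A∪_ : Fin m → Subset m
      A∪ a = A [ a ]≔ true

      AU E : List (Fin m)
      AU = elems A ++ elems U
      E = complement AU

      A∩U : ∀ {x} → x ∈ elems A → x ∉ elems U
      A∩U x∈A x∈U = Subset.x∈∁p⇒x∉p (A⊆∁U (elems-∈⁻ x∈A)) (elems-∈⁻ x∈U)

      AU-unique : Unique AU
      AU-unique = unique-++ (elems-unique A) (elems-unique U) A∩U

      E∉A : ∀ {a} → a ∈ E → a ∉ elems A
      E∉A a∈ a∈A = ∈-complement⁻ a∈ (∈-++⁺ˡ a∈A)

      E∉U : ∀ {a} → a ∈ E → a ∉ elems U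
      E∉U a∈ a∈U = ∈-complement⁻ a∈ (∈-++⁺ʳ (elems A) a∈U)

      length-E : k ℕ.+ n ℕ.+ length E ≡ m
      length-E = ≡.trans (≡.cong (ℕ._+ length E) (≡.sym (≡.trans (List.length-++ (elems A))
        (≡.cong₂ ℕ._+_ (≡.trans (length-elems A) card-A) (≡.trans (length-elems U) card-U)))))
        (length-complement AU-unique)

      ∁A-↭ : elems (∁ A) ↭ elems U ++ E
      ∁A-↭ = unique-↭ (elems-unique (∁ A))
        (unique-++ (elems-unique U) (complement-unique AU) (λ x∈U x∈E → E∉U x∈E x∈U)) to from
        where
        to : ∀ {x} → x ∈ elems (∁ A) → x ∈ elems U ++ E
        to {x} x∈ with x ∈? elems U
        ... | yes x∈U = ∈-++⁺ˡ x∈U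
        ... | no  x∉U = ∈-++⁺ʳ (elems U) (∈-complement⁺ λ x∈AU →
          [ (λ x∈A → Subset.x∈∁p⇒x∉p (elems-∈⁻ x∈) (elems-∈⁻ x∈A)) , x∉U ]′ (∈-++⁻ (elems A) x∈AU))
        from : ∀ {x} → x ∈ elems U ++ E → x ∈ elems (∁ A)
        from x∈ = elems-∈⁺ (Subset.x∉p⇒x∈∁p λ x∈A →
          [ A∩U (elems-∈⁺ x∈A) , (λ x∈E → E∉A x∈E (elems-∈⁺ x∈A)) ]′ (∈-++⁻ (elems U) x∈))

      -- The sign of moving `a` to the front of the ordered rows of `A∪ a`. It is indexed by `H`, as
      -- `pencil-identity` expects, with value `1#` at the points that do not come from an `a`
      -- outside `A`.
      sign : ∀ z → Σ Carrier λ ε → (ε * ε ≈ 1#) ×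
             (∀ {a} → ι a ≡ z → a ∉ elems A → RowSign (rowsOf (A∪ a)) (z ∷ as) ε)
      sign z with Fin.any? (λ a → ι a Fin.≟ z)
      ... | no  ∄a = 1# , *-identityˡ 1# , λ e → ⊥-elim (∄a (_ , e))
      ... | yes (a , ≡.refl) with a ∈? elems A
      ...   | yes a∈ = 1# , *-identityˡ 1# , λ e a∉ → ⊥-elim (a∉ (≡.subst (_∈ elems A) (≡.sym (ι-inj e)) a∈))
      ...   | no  a∉ with ↭⇒RowSign (Perm.map⁺ ι (elems-insert A a a∉))
      ...     | ε , ε² , s = ε , ε² , λ e _ → ≡.subst (λ b → RowSign (rowsOf (A∪ b)) (ι a ∷ as) ε) (≡.sym (ι-inj e)) s

      ε : Fin N → Carrier
      ε z = proj₁ (sign z)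

      module _ {a} (a∈E : a ∈ E) where

        private
          C = A∪ a

        C-↭ : elems C ↭ a ∷ elems A
        C-↭ = elems-insert A a (E∉A a∈E)

        card-C : ∣ C ∣ ≡ suc k
        card-C = ≡.trans (≡.sym (length-elems C)) (≡.trans (Perm.↭-length C-↭) (≡.cong suc (≡.trans (length-elems A) card-A)))

        Δ≈⟨⟩ : ∀ z → Δ z C ≈ ε (ι a) * ⟨ z , ι a ⟩
        Δ≈⟨⟩ z = RowSign-cons (proj₂ (proj₂ (sign (ι a))) ≡.refl (E∉A a∈E)) (suc k) h (h z) (≡.trans (length-rowsOf C) card-C)

        A⊆C : A ⊆ C
        A⊆C x∈ = elems-∈⁻ (Perm.∈-resp-↭ (↭-sym C-↭) (there (elems-∈⁺ x∈)))

        U∉C : ∀ {u} → u ∈ elems U → u ∉ elems C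
        U∉C u∈U u∈C with Perm.∈-resp-↭ C-↭ u∈C
        ... | here ≡.refl = E∉U a∈E u∈U
        ... | there u∈A   = A∩U u∈A u∈U

        C⊆∁U : C ⊆ ∁ U
        C⊆∁U x∈ = Subset.x∉p⇒x∈∁p λ x∈U → U∉C (elems-∈⁺ x∈U) (elems-∈⁺ x∈)

        Δ-as : ∀ {x} → x ∈ elems A → Δ (ι x) C ⁻ ≈ 1#
        Δ-as x∈ = ⁻-zero (Δ-repeated {C = C} card-C (∈-map⁺ ι (elems-∈⁺ (A⊆C (elems-∈⁻ x∈)))))

        -- The points of `A` are rows of `C`, so their determinants vanish and contribute the junk
        -- inverse `1#`. The point `ι a` stays in the product, again with factor `1#`.
        ∏-N : ∀ {o} → o ∉ as → ∏ (allFin N) (λ z → Δ z C ⁻) ≈ ∏ (o ∷ complement (o ∷ as)) (λ z → Δ z C ⁻)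
        ∏-N {o} o∉ = begin
          ∏ (allFin N) f                          ≈⟨ ∏-↭ f (↭-sym (++-complement-↭ (unique-∷ o∉ (rowsOf-unique A)))) ⟩
          f o * ∏ (as ++ complement (o ∷ as)) f   ≈⟨ *-congˡ (∏-++ as f) ⟩
          f o * (∏ as f * ∏ (complement (o ∷ as)) f)
            ≈⟨ *-congˡ (*-congʳ (trans (reflexive (∏-map ι (elems A) f)) (∏-one (elems A) Δ-as))) ⟩
          f o * (1# * ∏ (complement (o ∷ as)) f)  ≈⟨ *-congˡ (*-identityˡ _) ⟩
          f o * ∏ (complement (o ∷ as)) f         ∎
          where
          f : Fin N → Carrier
          f z = Δ z C ⁻

        -- The entry cancels the inverse determinants over `U`, and those over `A` are junk values
        -- `1#`; what is left lives on `E`.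
        ∏-m : ∏ (allFin m) (λ u → Δ (ι u) C ⁻) * ∏ (elems U) (λ u → Δ (ι u) C) ≈ ∏ E (λ u → Δ (ι u) C ⁻)
        ∏-m = begin
          ∏ (allFin m) f * P                      ≈⟨ *-congʳ (trans (∏-↭ f (↭-sym (++-complement-↭ AU-unique))) (trans (∏-++ AU f) (*-congʳ (∏-++ (elems A) f)))) ⟩
          ((∏ (elems A) f * ∏ (elems U) f) * ∏ E f) * P
            ≈⟨ *-congʳ (*-congʳ (*-congʳ (∏-one (elems A) Δ-as))) ⟩
          ((1# * ∏ (elems U) f) * ∏ E f) * P      ≈⟨ solve 3 (λ u e p → ((:1 :* u) :* e) :* p := e :* (p :* u)) refl _ _ _ ⟩
          ∏ E f * (P * ∏ (elems U) f)             ≈⟨ *-congˡ (∏-inverseʳ (elems U) (λ u∈ → Δ-≉0 {C = C} card-C (λ ιu∈ → U∉C u∈ (preimage ιu∈)))) ⟩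
          ∏ E f * 1#                              ≈⟨ *-identityʳ _ ⟩
          ∏ E f                                   ∎
          where
          f : Fin m → Carrier
          f u = Δ (ι u) C ⁻
          P = ∏ (elems U) (λ u → Δ (ι u) C)
          preimage : ∀ {u} → ι u ∈ rowsOf C → u ∈ elems C
          preimage ιu∈ with ∈-map⁻ ι ιu∈
          ... | v , v∈ , e = ≡.subst (_∈ elems C) (≡.sym (ι-inj e)) v∈

        column-term : ∀ {o xs} → o ∈ E → E ≡ o ∷ xs → functional C * entry C U A ≈
          ∏ (ι o ∷ complement (ι o ∷ as)) (λ z → (ε (ι a) * ⟨ z , ι a ⟩) ⁻) *
          ∏ (map ι (o ∷ xs)) (λ z → (ε (ι a) * ⟨ z , ι a ⟩) ⁻)
        column-term {o} {xs} o∈ E≡ = begin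
          functional C * entry C U A
            ≈⟨ *-cong (reflexive (functional-row {C} card-C)) (trans (reflexive (entry-valid {C} {U} {A} (card-U , card-A , A⊆∁U , A⊆C , C⊆∁U)))
                 (∏-cong (elems U) (λ _ → detB≈Δ _ C))) ⟩
          weights C * ∏ (elems U) (λ u → Δ (ι u) C)
            ≈⟨ trans (*-assoc _ _ _) (*-cong (∏-N o∉as) ∏-m) ⟩
          ∏ (ι o ∷ complement (ι o ∷ as)) (λ z → Δ z C ⁻) * ∏ E (λ u → Δ (ι u) C ⁻)
            ≈⟨ *-cong (∏-cong (ι o ∷ complement (ι o ∷ as)) (λ {z} _ → ⁻-cong (Δ≈⟨⟩ z)))
                 (trans (reflexive (≡.cong (λ l → ∏ l (λ u → Δ (ι u) C ⁻)) E≡)) (∏-cong (o ∷ xs) (λ {u} _ → ⁻-cong (Δ≈⟨⟩ (ι u))))) ⟩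
          ∏ (ι o ∷ complement (ι o ∷ as)) w * ∏ (o ∷ xs) (w ∘ ι)
            ≈⟨ *-congˡ (reflexive (≡.sym (∏-map ι (o ∷ xs) w))) ⟩
          ∏ (ι o ∷ complement (ι o ∷ as)) w * ∏ (map ι (o ∷ xs)) w ∎
          where
          w : Fin N → Carrier
          w z = (ε (ι a) * ⟨ z , ι a ⟩) ⁻
          o∉as : ι o ∉ as
          o∉as ιo∈ with ∈-map⁻ ι ιo∈
          ... | v , v∈ , e = E∉A o∈ (≡.subst (_∈ elems A) (≡.sym (ι-inj e)) v∈)

      ∑-E : ∀ {o xs} → E ≡ o ∷ xs → ∑ E (λ a → functional (A∪ a) * entry (A∪ a) U A) ≈ 0#
      ∑-E {o} {xs} E≡ = begin
        ∑ E (λ a → functional (A∪ a) * entry (A∪ a) U A)    ≈⟨ ∑-cong E (λ a∈ → column-term a∈ o∈ E≡) ⟩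
        ∑ E (T ∘ ι)                                         ≈⟨ reflexive (≡.cong (λ l → ∑ l (T ∘ ι)) E≡) ⟩
        ∑ (o ∷ xs) (T ∘ ι)                                  ≈⟨ reflexive (≡.sym (∑-map ι (o ∷ xs) T)) ⟩
        ∑ (map ι (o ∷ xs)) T                                ≈⟨ pencil-identity (ι o) (ι∉as o∈) ε (λ z → proj₁ (proj₂ (sign z))) uxs sub len f∈ ⟩
        0#                                                  ∎
        where
        zs = complement (ι o ∷ as)
        T : Fin N → Carrier
        T a = ∏ (ι o ∷ zs) (λ z → (ε a * ⟨ z , a ⟩) ⁻) * ∏ (map ι (o ∷ xs)) (λ z → (ε a * ⟨ z , a ⟩) ⁻)
        o∈ : o ∈ E
        o∈ = ≡.subst (o ∈_) (≡.sym E≡) (here ≡.refl)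
        ι∉as : ∀ {a} → a ∈ E → ι a ∉ as
        ι∉as a∈ ιa∈ with ∈-map⁻ ι ιa∈
        ... | v , v∈ , e = E∉A a∈ (≡.subst (_∈ elems A) (≡.sym (ι-inj e)) v∈)
        uE : Unique (map ι (o ∷ xs))
        uE = Unique.map⁺ ι-inj (≡.subst Unique E≡ (complement-unique AU))
        uxs : Unique (map ι xs)
        uxs with uE
        ... | _ ∷ u = u
        sub : ∀ {a} → a ∈ map ι xs → a ∈ zs
        sub {a} a∈ with ∈-map⁻ ι a∈
        ... | x , x∈ , ≡.refl = ∈-complement⁺ λ
          { (here e)     → Unique.Unique[x∷xs]⇒x∉xs uE (≡.subst (_∈ map ι xs) e a∈)
          ; (there x∈as) → ι∉as (≡.subst (x ∈_) (≡.sym E≡) (there x∈)) x∈as }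
        len-zs : suc k ℕ.+ length zs ≡ N
        len-zs = ≡.trans (≡.cong (λ r → suc r ℕ.+ length zs) (≡.sym (≡.trans (length-rowsOf A) card-A)))
                   (length-complement (unique-∷ (ι∉as o∈) (rowsOf-unique A)))
        len-xs : k ℕ.+ n ℕ.+ suc (length xs) ≡ m
        len-xs = ≡.trans (≡.cong (λ l → k ℕ.+ n ℕ.+ length l) (≡.sym E≡)) length-E
        -- `N` is `1 + k` plus the length of `zs`, and `m` is `k + n + 1` plus the length of `xs`;
        -- `count` leaves q + 1 for the two lengths together.
        len : length zs ℕ.+ length (map ι xs) ≡ suc q
        len = ≡.trans (≡.cong (length zs ℕ.+_) (List.length-map ι xs))
          (ℕ.+-cancelʳ-≡ (suc k ℕ.+ suc (k ℕ.+ n)) _ _ (≡.trans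
            (ℕ-Solver.solve 4 (λ z x k n → (z ⊞ x) ⊞ ((one ⊞ k) ⊞ (one ⊞ (k ⊞ n)))
                     ⊜ ((one ⊞ k) ⊞ z) ⊞ ((k ⊞ n) ⊞ (one ⊞ x))) ≡.refl (length zs) (length xs) k n)
            (≡.trans (≡.cong₂ ℕ._+_ len-zs len-xs) count)))
          where
          open ℕ-Solver using () renaming (_:+_ to _⊞_; _:=_ to _⊜_)
          one : ∀ {r} → ℕ-Solver.Polynomial r
          one = ℕ-Solver.con 1
        -- The second reference point `f` may be any point of `H` besides `ι o` and `as`; these take
        -- up `suc k` places, one fewer than the lower bound on `N`.
        nonempty : Σ (Fin N) (_∈ zs)
        nonempty with zs | len-zs
        ... | []    | e = ⊥-elim (ℕ.1+n≰n (ℕ.≤-trans large-N (ℕ.≤-reflexive (≡.trans (≡.sym e) (ℕ.+-identityʳ (suc k))))))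
        ... | z ∷ _ | _ = z , here ≡.refl
        f∈ = proj₂ nonempty

      orthogonal-column : ∑ (allSubsets m) (λ C → functional C * entry C U A) ≈ 0#
      orthogonal-column = begin
        ∑ (allSubsets m) (λ C → functional C * entry C U A)                ≈⟨ ∑-covers A support ⟩
        ∑ (elems (∁ A)) g                                                  ≈⟨ ∑-↭ g ∁A-↭ ⟩
        ∑ (elems U ++ E) g                                                 ≈⟨ ∑-++ (elems U) g ⟩
        ∑ (elems U) g + ∑ E g                                              ≈⟨ +-cong (∑-zero (elems U) on-U) on-E ⟩
        0# + 0#                                                            ≈⟨ +-identityˡ _ ⟩
        0#                                                                 ∎
        where
        g : Fin m → Carrier
        g a = functional (A∪ a) * entry (A∪ a) U A
        support : ∀ C → ¬ (A ⊆ C × ∣ C ∣ ≡ suc ∣ A ∣) → functional C * entry C U A ≈ 0#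
        support C ¬p with ∣ C ∣ ℕ.≟ suc k
        ... | yes card = trans (*-congˡ (reflexive (entry-invalid {C} {U} {A} λ (_ , _ , _ , A⊆C , _) → ¬p (A⊆C , ≡.trans card (≡.cong suc (≡.sym card-A)))))) (zeroʳ _)
        ... | no  card = trans (*-congʳ (reflexive (functional-other {C} card))) (zeroˡ _)
        -- Adding an element of `U` to `A` makes the row meet `U`, where the column is zero.
        on-U : ∀ {a} → a ∈ elems U → g a ≈ 0#
        on-U {a} a∈U = trans (*-congˡ (reflexive (entry-invalid {A∪ a} {U} {A} λ (_ , _ , _ , _ , C⊆∁U) →
          Subset.x∈∁p⇒x∉p (C⊆∁U (elems-∈⁻ a∈C)) (elems-∈⁻ a∈U)))) (zeroʳ _)
          where
          a∈C : a ∈ elems (A∪ a)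
          a∈C = Perm.∈-resp-↭ (↭-sym (elems-insert A a (λ a∈A → A∩U a∈A a∈U))) (here ≡.refl)
        on-E : ∑ E g ≈ 0#
        on-E = go E ≡.refl
          where
          go : ∀ l → E ≡ l → ∑ E g ≈ 0#
          go (o ∷ xs) E≡ = ∑-E E≡
          -- `A` and `U` together have `k + n` elements and `m` is larger, so some point of `E` is
          -- available to be put at infinity.
          go []       E≡ = ⊥-elim (ℕ.1+n≰n (ℕ.≤-trans large-m (ℕ.≤-reflexive
            (≡.trans (≡.sym (≡.trans (≡.cong (λ l → k ℕ.+ n ℕ.+ length l) (≡.sym E≡)) length-E)) (ℕ.+-identityʳ (k ℕ.+ n))))))

    orthogonal : ∀ U A → ∑ (allSubsets m) (λ C → functional C * entry C U A) ≈ 0#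
    orthogonal U A with (∣ U ∣ ℕ.≟ n) ×-dec (∣ A ∣ ℕ.≟ k) ×-dec (A Subset.⊆? ∁ U)
    ... | yes (card-U , card-A , A⊆∁U) = Column.orthogonal-column U A card-U card-A A⊆∁U
    ... | no  ¬p = ∑-zero (allSubsets m) (λ {C} _ → trans
            (*-congˡ (reflexive (entry-invalid {C} {U} {A} λ (u , a , d , _) → ¬p (u , a , d)))) (zeroʳ _))

    -- Pairing the combination of columns with `functional` gives zero column by column, but for a
    -- vector supported at `C₀` it gives a product of two nonzero elements.
    no-weight-one : ¬ ColSpaceHasWeightOne
    no-weight-one (x , C₀ , card , nz , zero-elsewhere) = ≉0-* (weights-≉0 C₀) nz (begin
      weights C₀ * colComb x C₀                                      ≈⟨ *-congʳ (reflexive (≡.sym (functional-row {C₀} card))) ⟩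
      functional C₀ * colComb x C₀                                   ≈⟨ sym (∑-allSubsets-single C₀ {λ C → functional C * colComb x C} off) ⟩
      ∑ S (λ C → functional C * colComb x C)                         ≈⟨ ∑-cong S (λ {C} _ → expand C) ⟩
      ∑ S (λ C → ∑ S (λ U → ∑ S (λ A → x U A * (functional C * entry C U A))))
        ≈⟨ ∑-swap S S _ ⟩
      ∑ S (λ U → ∑ S (λ C → ∑ S (λ A → x U A * (functional C * entry C U A))))
        ≈⟨ ∑-zero S (λ {U} _ → trans (∑-swap S S _) (∑-zero S (λ {A} _ →
             trans (∑-*ˡ S (x U A) _) (trans (*-congˡ (orthogonal U A)) (zeroʳ _))))) ⟩
      0# ∎)
      where
      S = allSubsets m
      off : ∀ C → C ≢ C₀ → functional C * colComb x C ≈ 0#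
      off C C≢C₀ with ∣ C ∣ ℕ.≟ suc k
      ... | yes card′ = trans (*-congˡ (zero-elsewhere C card′ C≢C₀)) (zeroʳ _)
      ... | no  card′ = trans (*-congʳ (reflexive (functional-other {C} card′))) (zeroˡ _)
      expand : ∀ C → functional C * colComb x C ≈ ∑ S (λ U → ∑ S (λ A → x U A * (functional C * entry C U A)))
      expand C = begin
        functional C * colComb x C
          ≈⟨ *-congˡ (∑-concatMap (λ U → map (λ A → entry C U A * x U A) S) S) ⟩
        functional C * ∑ S (λ U → ∑ S (λ A → entry C U A * x U A))
          ≈⟨ sym (∑-*ˡ S _ _) ⟩
        ∑ S (λ U → functional C * ∑ S (λ A → entry C U A * x U A))
          ≈⟨ ∑-cong S (λ {U} _ → trans (sym (∑-*ˡ S _ _)) (∑-cong S (λ {A} _ →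
               solve 3 (λ f e x → f :* (e :* x) := x :* (f :* e)) refl (functional C) (entry C U A) (x U A)))) ⟩
        ∑ S (λ U → ∑ S (λ A → x U A * (functional C * entry C U A))) ∎

-- From arc sizes to the counts used for orthogonality.

increasing⇒injective : ∀ {a b} (σ : Fin a → Fin b) → StrictlyIncreasing σ → ∀ {i j} → σ i ≡ σ j → i ≡ j
increasing⇒injective σ inc {i} {j} e with Fin.<-cmp i j
... | tri< i<j _ _ = ⊥-elim (Fin.<-irrefl e (inc i j i<j))
... | tri≈ _ i≡j _ = i≡j
... | tri> _ _ j<i = ⊥-elim (Fin.<-irrefl (≡.sym e) (inc j i j<i))

open import Data.Nat using (_+_; _*_; _∸_; _≤_)

theorem1p15 : ∀ {c ℓ} (F : FiniteField c ℓ) →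
    let open FiniteField F using (q) in
    let open Arcs F in
    ∀ {k m : ℕ} (G : Fin m → Vec k) → IsArc G → (n : ℕ) → 2 ≤ k →
    n + k ≤ m + 1 → m + m + 2 ≤ q + 2 * k + n →
    ∀ (B : Fin k → Vec k) (bB : IsBasis B) →
    Matrix.ColSpaceHasWeightOne G bB n →
    ¬ (Σ (Fin (q + 2 * k + n ∸ 1 ∸ m) → Vec k) λ H → IsArc H × ContainsSubfamily H G)
theorem1p15 F {suc (suc k)} {m} G _ n (ℕ.s≤s (ℕ.s≤s ℕ.z≤n)) large small B bB weight-one (H , (k≤N , arc) , ι , inc , ι-eq) =
  Field.Orthogonality.no-weight-one F {k} {m} {N} {n} G H arc ι (increasing⇒injective ι inc) ι-eq B bB k≤N large-m count weight-one
  where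
  q = FiniteField.q F
  N = q + 2 * suc (suc k) + n ∸ 1 ∸ m
  open ℕ-Solver using (solve; _:=_; con; _:+_)
  large-m : suc (k + n) ≤ m
  large-m = ℕ.+-cancelʳ-≤ 1 (suc (k + n)) m (≡.subst (_≤ m + 1)
    (solve 2 (λ n k → n :+ (con 2 :+ k) := (con 1 :+ (k :+ n)) :+ con 1) ≡.refl n k) large)
  total : q + 2 * suc (suc k) + n ≡ suc (suc q + (suc k + suc (k + n)))
  total = solve 3 (λ q k n → q :+ ((con 2 :+ k) :+ ((con 2 :+ k) :+ con 0)) :+ n
    := con 1 :+ ((con 1 :+ q) :+ ((con 1 :+ k) :+ (con 1 :+ (k :+ n))))) ≡.refl q k n
  -- The upper bound on `m` makes the truncated subtraction in `N` exact, so `count` can add `m`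
  -- back.
  m≤ : m ≤ suc q + (suc k + suc (k + n))
  m≤ = ℕ.≤-trans (ℕ.m≤m+n m (m + 1)) (ℕ.s≤s⁻¹ (≡.subst₂ _≤_
    (solve 1 (λ m → m :+ m :+ con 2 := con 1 :+ (m :+ (m :+ con 1))) ≡.refl m) total small))
  count : N + m ≡ suc q + (suc k + suc (k + n))
  count = ≡.trans (≡.cong (λ r → r ∸ 1 ∸ m + m) total) (ℕ.m∸n+n≡m m≤)
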